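{- Let $G=([n],E)$ be a connected undirected graph whose Laplacian has exactly $k+1$ distinct eigenvalues, and let $1\le t\le k-1$. Then there exists a proper subset $W\subsetneq[n]$ that is a uniformly weighted design of $G$ of strength $t$ if and only if the $t$-th eigenconfiguration $\mathcal{B}_t$ of $G$ is $2$-valued.
   Context: $[n]=\{1,\dots,n\}$. The Laplacian $L$ of $G$ is the $n\times n$ matrix with $L_{ii}=\deg(i)$, $L_{ij}=-1$ if $\{i,j\}\in E$, and $L_{ij}=0$ otherwise. Let $0=\lambda_0<\lambda_1<\cdots<\lambda_k$ be its distinct eigenvalues, with eigenspaces $\Lambda_0,\dots,\Lambda_k\subset\mathbb{R}^n$ (vectors are viewed as functions $[n]\to\mathbb{R}$) of dimensions $d_0,\dots,d_k$; $\Lambda_0$ is spanned by the all-ones vector. A subset $W\subset[n]$ with weights $a_w\in\mathbb{R}$ ($w\in W$) averages $f:[n]\to\mathbb{R}$ if $\frac1n\sum_{v\in[n]}f(v)=\sum_{w\in W}a_wf(w)$. It is a graphical design of strength $t$ if it averages every $f\in\Lambda_0\oplus\Lambda_1\oplus\cdots\oplus\Lambda_t$. The design is uniformly weighted if there is $a>0$ with $a_w=a$ for all $w\in W$; a set $W$ is called a uniformly weighted design of strength $t$ if it is one for some such $a$. Let $\beta=\sum_{i=t+1}^k d_i$ and let $B\in\mathbb{R}^{\beta\times n}$ be a matrix whose rows are the union of chosen bases of $\Lambda_{t+1},\dots,\Lambda_k$. The $t$-th eigenconfiguration $\mathcal{B}_t=\{b_1,\dots,b_n\}\subset\mathbb{R}^\beta$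 is the multiset of columns of $B$. (The choice of bases is arbitrary; different choices differ by an invertible linear transformation.) A point configuration $\mathcal{P}=\{p_1,\dots,p_r\}\subset\mathbb{R}^d$ that is not contained in an affine hyperplane is $2$-valued if there is a linear functional $a^\top x$ that takes exactly two values on the points of $\mathcal{P}$. -}

module Defs where

open import Algebra.Bundles using (CommutativeRing)
open import Algebra.Core using (Op₁; Op₂)
open import Algebra.Structures using (IsCommutativeRing)
import Algebra.Properties.Semiring.Mult as SemiringMult
import Algebra.Properties.Semiring.Sum as SemiringSum
open import Data.Bool.Base using (if_then_else_)
open import Data.Fin.Base using (Fin; zero; suc; cast; inject≤; _↑ʳ_)
import Data.Fin.Base as Fin
open import Data.Fin.Properties using (_≟_)
open import Data.Fin.Subset using (Subset; _∈_; ∣_∣)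
open import Data.Nat.Base as ℕ using (ℕ; zero; suc; _∸_)
open import Data.Nat.Properties using (m+[n∸m]≡n; <⇒≤)
open import Data.Product.Base using (∃; ∃₂; _×_)
open import Data.Sum.Base using (_⊎_)
import Data.Vec.Base as Vec
open import Data.Vec.Functional using (Vector; foldr; tail; _++_)
open import Level using (Level; _⊔_; 0ℓ) renaming (suc to lsuc)
open import Relation.Binary.Core using (Rel)
open import Relation.Binary.Construct.Closure.ReflexiveTransitive using (Star)
open import Relation.Binary.Definitions using (Decidable; Irreflexive; Symmetric)
open import Relation.Binary.PropositionalEquality.Core using (_≡_; cong)
open import Relation.Binary.Structures using (IsStrictTotalOrder)
open import Relation.Nullary.Decidable.Core using (does)
open import Relation.Nullary.Negation.Core using (¬_)
open import Relation.Unary using (Pred) renaming (_∈_ to _∈ₚ_)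

-- The real numbers enter through their axiomatic characterisation: classically,
-- a Dedekind-complete ordered field is unique up to isomorphism.

record CompleteOrderedField (c ℓ₁ ℓ₂ : Level) : Set (lsuc (c ⊔ ℓ₁ ⊔ ℓ₂)) where
  infix  8 _⁻¹ -_
  infixl 7 _*_
  infixl 6 _+_
  infix  4 _≈_ _<_ _≤_
  field
    Carrier            : Set c
    _≈_                : Rel Carrier ℓ₁
    _<_                : Rel Carrier ℓ₂
    _+_ _*_            : Op₂ Carrier
    -_                 : Op₁ Carrier
    0# 1#              : Carrier
    -- Total for convenience; 0# ⁻¹ is unconstrained.
    _⁻¹                : Op₁ Carrier
    isCommutativeRing  : IsCommutativeRing _≈_ _+_ _*_ -_ 0# 1#
    isStrictTotalOrder : IsStrictTotalOrder _≈_ _<_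
    0<1                : 0# < 1#
    *-inverseʳ         : ∀ x → ¬ (x ≈ 0#) → x * x ⁻¹ ≈ 1#
    +-monoˡ-<          : ∀ z {x y} → x < y → x + z < y + z
    *-pos              : ∀ {x y} → 0# < x → 0# < y → 0# < x * y

  _≤_ : Rel Carrier (ℓ₁ ⊔ ℓ₂)
  x ≤ y = x < y ⊎ x ≈ y

  UpperBound : ∀ {p} → Pred Carrier p → Pred Carrier (c ⊔ ℓ₁ ⊔ ℓ₂ ⊔ p)
  UpperBound P b = ∀ x → P x → x ≤ b

  field
    complete : ∀ (P : Pred Carrier (c ⊔ ℓ₁ ⊔ ℓ₂)) → ∃ P → ∃ (UpperBound P) →
               ∃ λ s → UpperBound P s × (∀ b → UpperBound P b → s ≤ b)

  commutativeRing : CommutativeRing c ℓ₁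
  commutativeRing = record { isCommutativeRing = isCommutativeRing }

record Graph (n : ℕ) : Set₁ where
  field
    E        : Rel (Fin n) 0ℓ
    E?       : Decidable E
    E-sym    : Symmetric E
    E-irrefl : Irreflexive _≡_ E

  deg : Fin n → ℕ
  deg i = ∣ Vec.tabulate (λ j → does (E? i j)) ∣

  Connected : Set
  Connected = ∀ i j → Star E i j

sumℕ : ∀ {m} → Vector ℕ m → ℕ
sumℕ = foldr ℕ._+_ 0

stack : ∀ {a} {A : Set a} {m} (d : Vector ℕ m) →
        (∀ j → Vector A (d j)) → Vector A (sumℕ d)
stack {m = zero}  d xs ()
stack {m = suc m} d xs = xs zero ++ stack (tail d) (λ j → xs (suc j))

-- lower and upper enumerate, in order, the parts {0,…,t} and {t+1,…,k} of
-- the index set {0,…,k}.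

lower : ∀ {t k} → t ℕ.< k → Fin (suc t) → Fin (suc k)
lower t<k i = inject≤ i (ℕ.s≤s (<⇒≤ t<k))

upper : ∀ {t k} → t ℕ.< k → Fin (k ∸ t) → Fin (suc k)
upper {t} t<k j = cast (cong suc (m+[n∸m]≡n (<⇒≤ t<k))) (suc t ↑ʳ j)

module OverReals {c ℓ₁ ℓ₂ : Level} (ℝ : CompleteOrderedField c ℓ₁ ℓ₂) where

  open CompleteOrderedField ℝ public
  open CommutativeRing commutativeRing using (semiring)
  open SemiringSum semiring public using (sum)
  open SemiringMult semiring public using () renaming (_×_ to _×ₙ_)

  ℝ^ : ℕ → Set c
  ℝ^ n = Vector Carrier n

  Matrix : ℕ → ℕ → Set c
  Matrix m n = Fin m → Fin n → Carrier

  ⟦_⟧ : ℕ → Carrier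
  ⟦ n ⟧ = n ×ₙ 1#

  infix 4 _≋_
  _≋_ : ∀ {n} → Rel (ℝ^ n) ℓ₁
  u ≋ v = ∀ i → u i ≈ v i

  0ᵥ : ∀ {n} → ℝ^ n
  0ᵥ _ = 0#

  infix 8 _∙_
  _∙_ : ∀ {n} → ℝ^ n → ℝ^ n → Carrier
  u ∙ v = sum λ i → u i * v i

  sumᵥ : ∀ {m n} → Vector (ℝ^ n) m → ℝ^ n
  sumᵥ vs i = sum λ j → vs j i

  combination : ∀ {m n} → ℝ^ m → Vector (ℝ^ n) m → ℝ^ n
  combination a vs = sumᵥ λ j i → a j * vs j i

  record IsBasis {n d} (U : Pred (ℝ^ n) ℓ₁) (b : Vector (ℝ^ n) d)
                 : Set (c ⊔ ℓ₁) where
    field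
      member      : ∀ j → b j ∈ₚ U
      independent : ∀ a → combination a b ≋ 0ᵥ → a ≋ 0ᵥ
      spanning    : ∀ u → u ∈ₚ U → ∃ λ a → u ≋ combination a b

  Eigenspace : ∀ {n} → Matrix n n → Carrier → Pred (ℝ^ n) ℓ₁
  Eigenspace M μ v = ∀ i → M i ∙ v ≈ μ * v i

  IsEigenvalue : ∀ {n} → Matrix n n → Pred Carrier (c ⊔ ℓ₁)
  IsEigenvalue M μ = ∃ λ v → ¬ (v ≋ 0ᵥ) × v ∈ₚ Eigenspace M μ

  record IsDistinctEigenvalues {n k} (M : Matrix n n) (ev : ℝ^ k)
                               : Set (c ⊔ ℓ₁ ⊔ ℓ₂) where
    field
      increasing : ∀ {i j} → i Fin.< j → ev i < ev j
      eigenvalue : ∀ i → IsEigenvalue M (ev i)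
      exhaustive : ∀ μ → IsEigenvalue M μ → ∃ λ i → μ ≈ ev i

  laplacian : ∀ {n} → Graph n → Matrix n n
  laplacian G i j =
    if does (i ≟ j) then ⟦ deg i ⟧ else
    if does (E? i j) then - 1# else 0#
    where open Graph G

  -- Membership in the sum of a finite family of subspaces.  The sum is not
  -- required to be direct, which is automatic for distinct eigenvalues.
  SumOf : ∀ {m n} → Vector (Pred (ℝ^ n) ℓ₁) m → Pred (ℝ^ n) (c ⊔ ℓ₁)
  SumOf Us f = ∃ λ g → (∀ i → g i ∈ₚ Us i) × f ≋ sumᵥ g

  -- Weights are given on all of [n], but only those of elements of W are used.
  Averages : ∀ {n} → Subset n → ℝ^ n → Pred (ℝ^ n) ℓ₁
  Averages {n} W a f =
    ⟦ n ⟧ ⁻¹ * sum f ≈ sum (λ w → if Vec.lookup W w then a w * f w else 0#)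

  IsDesign : ∀ {n k t} → Graph n → ℝ^ (suc k) → t ℕ.< k →
             Subset n → Pred (ℝ^ n) (c ⊔ ℓ₁)
  IsDesign G ev t<k W a =
    ∀ f → f ∈ₚ SumOf (λ i → Eigenspace (laplacian G) (ev (lower t<k i))) →
    Averages W a f

  UniformlyWeighted : ∀ {n} → Subset n → Pred (ℝ^ n) (c ⊔ ℓ₁ ⊔ ℓ₂)
  UniformlyWeighted W a = ∃ λ α → 0# < α × (∀ w → w ∈ W → a w ≈ α)

  IsUniformDesign : ∀ {n k t} → Graph n → ℝ^ (suc k) → t ℕ.< k →
                    Pred (Subset n) (c ⊔ ℓ₁ ⊔ ℓ₂)
  IsUniformDesign G ev t<k W =
    ∃ λ a → UniformlyWeighted W a × IsDesign G ev t<k W a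

  -- A point configuration is a family of points, so that points may repeat.
  eigenconfiguration : ∀ {n m} (d : Vector ℕ m) →
                       (∀ j → Vector (ℝ^ n) (d j)) → Vector (ℝ^ (sumℕ d)) n
  eigenconfiguration d bases v = λ r → B r v
    where
    B : Matrix (sumℕ d) _
    B = stack d bases

  InAffineHyperplane : ∀ {r d} → Vector (ℝ^ d) r → Set (c ⊔ ℓ₁)
  InAffineHyperplane p =
    ∃₂ λ a x → ¬ (a ≋ 0ᵥ) × (∀ i → a ∙ p i ≈ x)

  ExactlyTwoValues : ∀ {r} → ℝ^ r → Set (c ⊔ ℓ₁)
  ExactlyTwoValues f =
    ∃₂ λ x y → ¬ (x ≈ y) × (∃ λ i → f i ≈ x) × (∃ λ i → f i ≈ y) ×
               (∀ i → f i ≈ x ⊎ f i ≈ y)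

  TwoValued : ∀ {r d} → Vector (ℝ^ d) r → Set (c ⊔ ℓ₁)
  TwoValued p =
    ¬ InAffineHyperplane p × ∃ λ a → ExactlyTwoValues (λ i → a ∙ p i)

{-# OPTIONS --safe #-}
module Submission where

-- Averaging every f in Λ₀ ⊕ … ⊕ Λₜ with constant weight α means that
-- g = α χ_W - 1/n is orthogonal to Λ₀, …, Λₜ.  By the spectral theorem for L this
-- puts g in Λₜ₊₁ ⊕ … ⊕ Λₖ, the row space of B, so g = aᵀB is a functional taking
-- two values on the columns of B.  Conversely a functional aᵀB with values x ≠ y
-- is x 1 + (y - x) χ_W with W the set where it equals y; orthogonality to 1 ∈ Λ₀
-- determines x, and aᵀB is a non-zero multiple of g with α = 1/|W|.
--
-- The spectral theorem is proved without compactness: on an invariant span, the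
-- supremum μ of the Rayleigh quotients makes μ - L positive semidefinite but not
-- coercive, hence degenerate, which yields an eigenvector.  So Π (L - λᵢ), whose
-- range can contain no eigenvector, vanishes.

-- Bases are given for the upper eigenspaces only, and no dimensions are known to add up to n. So it
-- cannot be had by counting that the row space of B is the whole orthogonal complement of Λ₀ ⊕ ...
-- ⊕ Λₜ. Instead the vanishing product is split as A₁ A₂, the factors of the lower and of the upper
-- eigenvalues. For g orthogonal to the lower eigenspaces, A₂ g is killed by A₁ and still orthogonal
-- to them, hence 0; and a vector killed by A₂ is a sum of upper eigenvectors by partial fractions.
--
-- Completeness provides suprema, not maximisers. The substitute for a maximiser is a dichotomy for
-- a form that is positive semidefinite on a finite span: either it has a nonzero radical there, or
-- it dominates a positive multiple of the squared norm. An elimination on the generators decides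
-- which, since trichotomy makes equality decidable. At the supremum of the Rayleigh quotients the
-- second alternative is impossible, and a radical vector is an eigenvector because the span is
-- invariant.

open import Defs
open import Algebra.Bundles using (CommutativeRing)
import Algebra.Properties.Ring as RingProperties
import Algebra.Properties.Semiring.Mult.TCOptimised as SemiringMult′
import Algebra.Properties.Semiring.Sum as SemiringSum
import Algebra.Solver.Ring as RingSolver
open import Algebra.Solver.Ring.AlmostCommutativeRing
  using (fromCommutativeRing; _-Raw-AlmostCommutative⟶_)
open import Data.Bool.Base using (Bool; true; false; if_then_else_)
open import Data.Fin.Base as Fin using (Fin; zero; suc; toℕ; fromℕ<; _↑ˡ_; _↑ʳ_)
import Data.Fin.Properties as Fin
open import Data.Fin.Subset using (Subset; _⊂_; ⊤; _∈_; _∉_; ∣_∣; Nonempty)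
open import Data.Fin.Subset.Properties using (⊆⊤; ∈⊤; nonempty?)
open import Data.Integer.Base as ℤ using (ℤ; +_; -[1+_])
import Data.Integer.Properties as ℤ
open import Data.Maybe.Base using (Maybe; just; nothing)
open import Data.Nat.Base as ℕ using (ℕ; zero; suc; _∸_)
import Data.Nat.Properties as ℕ
open import Data.Product.Base using (∃; ∃₂; _×_; _,_; proj₁; proj₂)
import Data.Sign.Base as Sign
open import Data.Sum.Base using (_⊎_; inj₁; inj₂)
open import Data.Vec.Base using (lookup; tabulate)
open import Data.Vec.Functional using (Vector; tail)
open import Data.Vec.Functional.Properties using (lookup-++ˡ; lookup-++ʳ)
open import Data.Vec.Properties using (lookup∘tabulate; lookup⇒[]=; []=⇒lookup)
open import Function.Base using (_∘_)
open import Function.Bundles using (_⇔_; mk⇔)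
open import Level using (Level; _⊔_)
open import Relation.Binary.Bundles using (TotalOrder)
import Relation.Binary.Construct.StrictToNonStrict as StrictToNonStrict
open import Relation.Binary.Definitions using (tri<; tri≈; tri>)
open import Relation.Binary.PropositionalEquality as ≡ using (_≡_; _≢_)
open import Relation.Binary.Structures using (IsStrictTotalOrder)
open import Relation.Nullary.Decidable
  using (Dec; yes; no; does; decidable-stable; dec-true; dec-false)
open import Relation.Nullary.Negation using (¬_; contradiction)
open import Relation.Unary using (Pred)

-- The ring solver needs coefficients with computing equality, so that x - x
-- cancels although equality in R does not compute.
module IntegerSolver {c ℓ : Level} (R : CommutativeRing c ℓ) where

  open CommutativeRing R
  open RingProperties ring
  open SemiringMult′ semiring using (1+×; ×-homo-+; ×1-homo-*) renaming (_×_ to _×′_)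
  open import Relation.Binary.Reasoning.Setoid setoid

  -- `_×′_` is the variant of multiples for which `1 ×′ 1#` reduces to `1#`, so `con (+ 1)` in the
  -- solver denotes `1#` definitionally.
  fromℤ : ℤ → Carrier
  fromℤ (+ n)    = n ×′ 1#
  fromℤ -[1+ n ] = - (suc n ×′ 1#)

  fromℤ-⊖ : ∀ m n → fromℤ (m ℤ.⊖ n) ≈ m ×′ 1# - n ×′ 1#
  fromℤ-⊖ m zero = begin
    m ×′ 1#       ≈⟨ +-identityʳ _ ⟨
    m ×′ 1# + 0#  ≈⟨ +-congˡ -0#≈0# ⟨
    m ×′ 1# - 0#  ∎
  fromℤ-⊖ zero (suc n) = sym (+-identityˡ _)
  fromℤ-⊖ (suc m) (suc n) = begin
    fromℤ (suc m ℤ.⊖ suc n)  ≡⟨ ≡.cong fromℤ (ℤ.[1+m]⊖[1+n]≡m⊖n m n) ⟩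
    fromℤ (m ℤ.⊖ n)          ≈⟨ fromℤ-⊖ m n ⟩
    m ×′ 1# - n ×′ 1#                    ≈⟨ cancel ⟨
    1# + m ×′ 1# - (1# + n ×′ 1#)        ≈⟨ +-cong (1+× m 1#) (-‿cong (1+× n 1#)) ⟨
    suc m ×′ 1# - suc n ×′ 1#            ∎
    where
    cancel : ∀ {x y} → 1# + x - (1# + y) ≈ x - y
    cancel {x} {y} = begin
      1# + x - (1# + y)      ≈⟨ +-cong (+-comm 1# x) (sym (-‿+-comm 1# y)) ⟩
      x + 1# + (- 1# - y)    ≈⟨ +-assoc x 1# _ ⟩
      x + (1# + (- 1# - y))  ≈⟨ +-congˡ (+-assoc 1# (- 1#) (- y)) ⟨
      x + (1# - 1# - y)      ≈⟨ +-congˡ (+-congʳ (-‿inverseʳ 1#)) ⟩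
      x + (0# - y)           ≈⟨ +-congˡ (+-identityˡ (- y)) ⟩
      x - y                  ∎

  fromℤ-neg : ∀ i → fromℤ (ℤ.- i) ≈ - fromℤ i
  fromℤ-neg (+ zero)  = sym -0#≈0#
  fromℤ-neg (+ suc n) = refl
  fromℤ-neg -[1+ n ]  = sym (-‿involutive _)

  fromℤ-+ : ∀ i j → fromℤ (i ℤ.+ j) ≈ fromℤ i + fromℤ j
  fromℤ-+ (+ m)    (+ n)    = ×-homo-+ 1# m n
  fromℤ-+ (+ m)    -[1+ n ] = fromℤ-⊖ m (suc n)
  fromℤ-+ -[1+ m ] (+ n)    = trans (fromℤ-⊖ n (suc m)) (+-comm _ _)
  fromℤ-+ -[1+ m ] -[1+ n ] = begin
    - (suc (suc (m ℕ.+ n)) ×′ 1#)        ≡⟨ ≡.cong (λ k → - (suc k ×′ 1#)) (ℕ.+-suc m n) ⟨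
    - ((suc m ℕ.+ suc n) ×′ 1#)          ≈⟨ -‿cong (×-homo-+ 1# (suc m) (suc n)) ⟩
    - (suc m ×′ 1# + suc n ×′ 1#)        ≈⟨ -‿+-comm _ _ ⟨
    - (suc m ×′ 1#) - suc n ×′ 1#        ∎

  fromℤ-+◃ : ∀ n → fromℤ (Sign.+ ℤ.◃ n) ≈ n ×′ 1#
  fromℤ-+◃ n = reflexive (≡.cong fromℤ (ℤ.+◃n≡+n n))

  fromℤ-‿◃ : ∀ n → fromℤ (Sign.- ℤ.◃ n) ≈ - (n ×′ 1#)
  fromℤ-‿◃ n = trans (reflexive (≡.cong fromℤ (ℤ.-◃n≡-n n))) (fromℤ-neg (+ n))

  fromℤ-* : ∀ i j → fromℤ (i ℤ.* j) ≈ fromℤ i * fromℤ j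
  fromℤ-* (+ m)    (+ n)    = trans (fromℤ-+◃ (m ℕ.* n)) (×1-homo-* m n)
  fromℤ-* (+ m)    -[1+ n ] = begin
    fromℤ (Sign.- ℤ.◃ (m ℕ.* suc n))  ≈⟨ fromℤ-‿◃ (m ℕ.* suc n) ⟩
    - ((m ℕ.* suc n) ×′ 1#)            ≈⟨ -‿cong (×1-homo-* m (suc n)) ⟩
    - (m ×′ 1# * (suc n ×′ 1#))        ≈⟨ -‿distribʳ-* _ _ ⟩
    m ×′ 1# * - (suc n ×′ 1#)          ∎
  fromℤ-* -[1+ m ] (+ n)    = begin
    fromℤ (Sign.- ℤ.◃ (suc m ℕ.* n))  ≈⟨ fromℤ-‿◃ (suc m ℕ.* n) ⟩
    - ((suc m ℕ.* n) ×′ 1#)            ≈⟨ -‿cong (×1-homo-* (suc m) n) ⟩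
    - (suc m ×′ 1# * (n ×′ 1#))        ≈⟨ -‿distribˡ-* _ _ ⟩
    - (suc m ×′ 1#) * (n ×′ 1#)        ∎
  fromℤ-* -[1+ m ] -[1+ n ] = begin
    fromℤ (Sign.+ ℤ.◃ (suc m ℕ.* suc n))  ≈⟨ fromℤ-+◃ (suc m ℕ.* suc n) ⟩
    (suc m ℕ.* suc n) ×′ 1#                ≈⟨ ×1-homo-* (suc m) (suc n) ⟩
    suc m ×′ 1# * (suc n ×′ 1#)            ≈⟨ -‿involutive _ ⟨
    - - (suc m ×′ 1# * (suc n ×′ 1#))      ≈⟨ -‿cong (-‿distribˡ-* _ _) ⟩
    - (- (suc m ×′ 1#) * (suc n ×′ 1#))    ≈⟨ -‿distribʳ-* _ _ ⟩
    - (suc m ×′ 1#) * - (suc n ×′ 1#)      ∎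

  -- `nothing` only means that no proof is offered: distinct integers may have equal images in R.
  fromℤ-≟ : ∀ i j → Maybe (fromℤ i ≈ fromℤ j)
  fromℤ-≟ i j with i ℤ.≟ j
  ... | yes i≡j = just (reflexive (≡.cong fromℤ i≡j))
  ... | no  _   = nothing

  fromℤ-morphism : ℤ.+-*-rawRing -Raw-AlmostCommutative⟶ fromCommutativeRing R
  fromℤ-morphism = record
    { ⟦_⟧    = fromℤ
    ; +-homo = fromℤ-+
    ; *-homo = fromℤ-*
    ; -‿homo = fromℤ-neg
    ; 0-homo = refl
    ; 1-homo = refl
    }

  open RingSolver ℤ.+-*-rawRing (fromCommutativeRing R) fromℤ-morphism fromℤ-≟ public
    using (solve; con; _:+_; _:*_; _:-_; :-_; _:=_)

-- Order, inverses and finite sums in an ordered field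

module OrderedFieldProperties {c ℓ₁ ℓ₂ : Level} (ℝ : CompleteOrderedField c ℓ₁ ℓ₂) where

  open OverReals ℝ public
  open CommutativeRing commutativeRing public
    using ( refl; sym; trans; reflexive; setoid; semiring; _-_
          ; +-cong; +-congˡ; +-congʳ; *-cong; *-congˡ; *-congʳ; -‿cong
          ; +-identityˡ; +-identityʳ; *-identityˡ; *-identityʳ; *-comm
          ; zeroˡ; zeroʳ; -‿inverseʳ)
  open IntegerSolver commutativeRing public using (solve; con; _:+_; _:*_; _:-_; :-_; _:=_)
  open SemiringSum semiring public
    using (sum-cong-≋; ∑-distrib-+; ∑-comm; sum-replicate; *-distribˡ-sum; *-distribʳ-sum)
  open IsStrictTotalOrder isStrictTotalOrder public
    using (compare; irrefl; asym; <-respʳ-≈; <-respˡ-≈) renaming (_≟_ to _≈?_; trans to <-trans)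
  open import Relation.Binary.Reasoning.Setoid setoid public

  totalOrder : TotalOrder c ℓ₁ (ℓ₁ ⊔ ℓ₂)
  totalOrder = record
    { isTotalOrder = StrictToNonStrict.isTotalOrder _≈_ _<_ isStrictTotalOrder }

  open TotalOrder totalOrder public
    using (≤-respʳ-≈; ≤-respˡ-≈)
    renaming (refl to ≤-refl; trans to ≤-trans; total to ≤-total; antisym to ≤-antisym)

  <⇒≱ : ∀ {x y} → x < y → ¬ (y ≤ x)
  <⇒≱ x<y (inj₁ y<x) = asym x<y y<x
  <⇒≱ x<y (inj₂ y≈x) = irrefl (sym y≈x) x<y

  pos⇒≉0 : ∀ {x} → 0# < x → ¬ (x ≈ 0#)
  pos⇒≉0 0<x x≈0 = irrefl (sym x≈0) 0<x

  nonneg∧≉0⇒pos : ∀ {x} → 0# ≤ x → ¬ (x ≈ 0#) → 0# < x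
  nonneg∧≉0⇒pos (inj₁ 0<x) _   = 0<x
  nonneg∧≉0⇒pos (inj₂ 0≈x) x≉0 = contradiction (sym 0≈x) x≉0

  1≉0 : ¬ (1# ≈ 0#)
  1≉0 = pos⇒≉0 0<1

  x-y≈0⇒x≈y : ∀ {x y} → x - y ≈ 0# → x ≈ y
  x-y≈0⇒x≈y {x} {y} eq = begin
    x            ≈⟨ solve 2 (λ x y → x := x :- y :+ y) refl x y ⟩
    x - y + y    ≈⟨ +-congʳ eq ⟩
    0# + y       ≈⟨ +-identityˡ y ⟩
    y            ∎

  x≈y⇒x-y≈0 : ∀ {x y} → x ≈ y → x - y ≈ 0#
  x≈y⇒x-y≈0 {x} {y} eq = trans (+-congʳ eq) (-‿inverseʳ y)

  +-monoˡ-≤ : ∀ z {x y} → x ≤ y → x + z ≤ y + z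
  +-monoˡ-≤ z (inj₁ x<y) = inj₁ (+-monoˡ-< z x<y)
  +-monoˡ-≤ z (inj₂ x≈y) = inj₂ (+-congʳ x≈y)

  x≤y⇒0≤y-x : ∀ {x y} → x ≤ y → 0# ≤ y - x
  x≤y⇒0≤y-x {x} x≤y = ≤-respˡ-≈ (-‿inverseʳ x) (+-monoˡ-≤ (- x) x≤y)

  0≤y-x⇒x≤y : ∀ {x y} → 0# ≤ y - x → x ≤ y
  0≤y-x⇒x≤y {x} {y} h = ≤-respˡ-≈ (+-identityˡ x)
    (≤-respʳ-≈ (solve 2 (λ x y → y :- x :+ x := y) refl x y) (+-monoˡ-≤ x h))

  x<y⇒0<y-x : ∀ {x y} → x < y → 0# < y - x
  x<y⇒0<y-x {x} x<y = <-respˡ-≈ (-‿inverseʳ x) (+-monoˡ-< (- x) x<y)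

  0<y-x⇒x<y : ∀ {x y} → 0# < y - x → x < y
  0<y-x⇒x<y {x} {y} h = <-respˡ-≈ (+-identityˡ x)
    (<-respʳ-≈ (solve 2 (λ x y → y :- x :+ x := y) refl x y) (+-monoˡ-< x h))

  neg⇒0<- : ∀ {x} → x < 0# → 0# < - x
  neg⇒0<- {x} x<0 = <-respʳ-≈ (+-identityˡ (- x)) (x<y⇒0<y-x x<0)

  +-nonneg : ∀ {x y} → 0# ≤ x → 0# ≤ y → 0# ≤ x + y
  +-nonneg {x} {y} 0≤x 0≤y = ≤-trans 0≤y (≤-respˡ-≈ (+-identityˡ y) (+-monoˡ-≤ y 0≤x))

  +-mono-≤ : ∀ {x y u v} → x ≤ y → u ≤ v → x + u ≤ y + v
  +-mono-≤ {x} {y} {u} {v} x≤y u≤v = 0≤y-x⇒x≤y (≤-respʳ-≈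
    (solve 4 (λ x y u v → y :- x :+ (v :- u) := y :+ v :- (x :+ u)) refl x y u v)
    (+-nonneg (x≤y⇒0≤y-x x≤y) (x≤y⇒0≤y-x u≤v)))

  *-nonneg : ∀ {x y} → 0# ≤ x → 0# ≤ y → 0# ≤ x * y
  *-nonneg         (inj₁ 0<x) (inj₁ 0<y) = inj₁ (*-pos 0<x 0<y)
  *-nonneg {x} {y} (inj₂ 0≈x) _          = inj₂ (trans (sym (zeroˡ y)) (*-congʳ 0≈x))
  *-nonneg {x} {y} _          (inj₂ 0≈y) = inj₂ (trans (sym (zeroʳ x)) (*-congˡ 0≈y))

  *-monoˡ-≤ : ∀ {z} → 0# ≤ z → ∀ {x y} → x ≤ y → z * x ≤ z * y
  *-monoˡ-≤ {z} 0≤z {x} {y} x≤y = 0≤y-x⇒x≤y (≤-respʳ-≈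
    (solve 3 (λ x y z → z :* (y :- x) := z :* y :- z :* x) refl x y z)
    (*-nonneg 0≤z (x≤y⇒0≤y-x x≤y)))

  square-nonneg : ∀ x → 0# ≤ x * x
  square-nonneg x with compare 0# x
  ... | tri< 0<x _ _ = inj₁ (*-pos 0<x 0<x)
  ... | tri≈ _ 0≈x _ = *-nonneg (inj₂ 0≈x) (inj₂ 0≈x)
  ... | tri> _ _ x<0 = inj₁ (<-respʳ-≈ (solve 1 (λ x → (:- x) :* (:- x) := x :* x) refl x)
                               (*-pos (neg⇒0<- x<0) (neg⇒0<- x<0)))

  *-inverseˡ : ∀ x → ¬ (x ≈ 0#) → x ⁻¹ * x ≈ 1#
  *-inverseˡ x x≉0 = trans (*-comm _ _) (*-inverseʳ x x≉0)

  *-cancelˡ : ∀ {x y z} → ¬ (x ≈ 0#) → x * y ≈ x * z → y ≈ z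
  *-cancelˡ {x} {y} {z} x≉0 xy≈xz = begin
    y                ≈⟨ *-identityˡ y ⟨
    1# * y           ≈⟨ *-congʳ (*-inverseʳ x x≉0) ⟨
    x * x ⁻¹ * y     ≈⟨ swap y ⟩
    x ⁻¹ * (x * y)   ≈⟨ *-congˡ xy≈xz ⟩
    x ⁻¹ * (x * z)   ≈⟨ swap z ⟨
    x * x ⁻¹ * z     ≈⟨ *-congʳ (*-inverseʳ x x≉0) ⟩
    1# * z           ≈⟨ *-identityˡ z ⟩
    z                ∎
    where
    swap : ∀ w → x * x ⁻¹ * w ≈ x ⁻¹ * (x * w)
    swap = solve 3 (λ x i w → x :* i :* w := i :* (x :* w)) refl x (x ⁻¹)

  *-≈0 : ∀ {x y} → ¬ (x ≈ 0#) → x * y ≈ 0# → y ≈ 0#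
  *-≈0 {x} x≉0 xy≈0 = *-cancelˡ x≉0 (trans xy≈0 (sym (zeroʳ x)))

  square≈0 : ∀ {x} → x * x ≈ 0# → x ≈ 0#
  square≈0 {x} xx≈0 with x ≈? 0#
  ... | yes x≈0 = x≈0
  ... | no  x≉0 = *-≈0 x≉0 xx≈0

  ⁻¹-pos : ∀ {x} → 0# < x → 0# < x ⁻¹
  ⁻¹-pos {x} 0<x with compare 0# (x ⁻¹)
  ... | tri< 0<x⁻¹ _ _ = 0<x⁻¹
  ... | tri≈ _ 0≈x⁻¹ _ = contradiction
        (trans (sym (*-inverseʳ x (pos⇒≉0 0<x))) (trans (*-congˡ (sym 0≈x⁻¹)) (zeroʳ x))) 1≉0
  ... | tri> _ _ x⁻¹<0 = contradiction (inj₁ 1<0) (<⇒≱ 0<1)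
    where
    1<0 : 1# < 0#
    1<0 = 0<y-x⇒x<y (<-respʳ-≈ (begin
      x * - (x ⁻¹)      ≈⟨ solve 2 (λ x i → x :* (:- i) := con (+ 0) :- x :* i) refl x (x ⁻¹) ⟩
      0# - x * x ⁻¹   ≈⟨ +-congˡ (-‿cong (*-inverseʳ x (pos⇒≉0 0<x))) ⟩
      0# - 1#         ∎) (*-pos 0<x (neg⇒0<- x⁻¹<0)))

  *-cancelˡ-≤ : ∀ {z x y} → 0# < z → z * x ≤ z * y → x ≤ y
  *-cancelˡ-≤ {z} {x} {y} 0<z zx≤zy = ≤-respˡ-≈ (cancel x) (≤-respʳ-≈ (cancel y)
    (*-monoˡ-≤ (inj₁ (⁻¹-pos 0<z)) zx≤zy))
    where
    cancel : ∀ w → z ⁻¹ * (z * w) ≈ w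
    cancel w = begin
      z ⁻¹ * (z * w)   ≈⟨ solve 3 (λ i z w → i :* (z :* w) := z :* i :* w) refl (z ⁻¹) z w ⟩
      z * z ⁻¹ * w     ≈⟨ *-congʳ (*-inverseʳ z (pos⇒≉0 0<z)) ⟩
      1# * w           ≈⟨ *-identityˡ w ⟩
      w                ∎

  -- With a nonzero slope the value at t = - (q + 1) / b would be -1.
  affine-nonneg⇒slope≈0 : ∀ {q b} → (∀ t → 0# ≤ q + t * b) → b ≈ 0#
  affine-nonneg⇒slope≈0 {q} {b} nonneg with b ≈? 0#
  ... | yes b≈0 = b≈0
  ... | no  b≉0 = contradiction
        (≤-respʳ-≈ (begin
          q + - (q + 1#) * b ⁻¹ * b
            ≈⟨ solve 4 (λ q o i b → q :+ (:- (q :+ o)) :* i :* b := q :- (q :+ o) :* (i :* b))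
                 refl q 1# (b ⁻¹) b ⟩
          q - (q + 1#) * (b ⁻¹ * b)
            ≈⟨ +-congˡ (-‿cong (*-congˡ (*-inverseˡ b b≉0))) ⟩
          q - (q + 1#) * 1#
            ≈⟨ solve 1 (λ q → q :- (q :+ con (+ 1)) :* con (+ 1) := con (+ 0) :- con (+ 1)) refl q ⟩
          0# - 1#  ∎)
          (nonneg (- (q + 1#) * b ⁻¹)))
        (λ 0≤-1 → <⇒≱ 0<1 (0≤y-x⇒x≤y 0≤-1))

  -- Cruder than the bound by half the right side, but free of division: for nonnegative x y the
  -- difference is (x - y)² + x y, otherwise the signs decide.
  xy≤xx+yy : ∀ x y → x * y ≤ x * x + y * y
  xy≤xx+yy x y with ≤-total 0# (x * y)
  ... | inj₁ 0≤xy = 0≤y-x⇒x≤y (≤-respʳ-≈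
    (solve 2 (λ x y → (x :- y) :* (x :- y) :+ x :* y := x :* x :+ y :* y :- x :* y) refl x y)
    (+-nonneg (square-nonneg (x - y)) 0≤xy))
  ... | inj₂ xy≤0 = ≤-trans xy≤0 (+-nonneg (square-nonneg x) (square-nonneg y))

  nonneg⇒0<x+1 : ∀ {x} → 0# ≤ x → 0# < x + 1#
  nonneg⇒0<x+1 (inj₁ 0<x) = <-trans 0<1 (<-respˡ-≈ (+-identityˡ 1#) (+-monoˡ-< 1# 0<x))
  nonneg⇒0<x+1 (inj₂ 0≈x) = <-respʳ-≈ (trans (sym (+-identityˡ 1#)) (+-congʳ 0≈x)) 0<1

  x+x≈0⇒x≈0 : ∀ {x} → x + x ≈ 0# → x ≈ 0#
  x+x≈0⇒x≈0 {x} eq = *-≈0 (pos⇒≉0 (nonneg⇒0<x+1 (inj₁ 0<1)))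
    (trans (solve 1 (λ x → (con (+ 1) :+ con (+ 1)) :* x := x :+ x) refl x) eq)

  ⟦suc⟧-pos : ∀ n → 0# < ⟦ suc n ⟧
  ⟦suc⟧-pos zero    = <-respʳ-≈ (sym (+-identityʳ 1#)) 0<1
  ⟦suc⟧-pos (suc n) = <-trans (⟦suc⟧-pos n)
    (<-respˡ-≈ (+-identityˡ _) (+-monoˡ-< ⟦ suc n ⟧ 0<1))

  Fin⇒⟦⟧-pos : ∀ {n} → Fin n → 0# < ⟦ n ⟧
  Fin⇒⟦⟧-pos {suc n} _ = ⟦suc⟧-pos n

  sum-zero : ∀ {n} {f : Vector Carrier n} → (∀ i → f i ≈ 0#) → sum f ≈ 0#
  sum-zero {zero}  f≈0 = refl
  sum-zero {suc n} f≈0 = trans (+-cong (f≈0 zero) (sum-zero (f≈0 ∘ suc))) (+-identityˡ 0#)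

  sum-single : ∀ {n} {f : Vector Carrier n} j → (∀ i → i ≢ j → f i ≈ 0#) → sum f ≈ f j
  sum-single zero    f≈0 = trans (+-congˡ (sum-zero λ i → f≈0 (suc i) λ ())) (+-identityʳ _)
  sum-single (suc j) f≈0 = trans
    (+-cong (f≈0 zero λ ()) (sum-single j λ i i≢j → f≈0 (suc i) (i≢j ∘ Fin.suc-injective)))
    (+-identityˡ _)

  sum-nonneg : ∀ {n} {f : Vector Carrier n} → (∀ i → 0# ≤ f i) → 0# ≤ sum f
  sum-nonneg {zero}  0≤f = ≤-refl
  sum-nonneg {suc n} 0≤f = +-nonneg (0≤f zero) (sum-nonneg (0≤f ∘ suc))

  sum-mono-≤ : ∀ {n} {f g : Vector Carrier n} → (∀ i → f i ≤ g i) → sum f ≤ sum g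
  sum-mono-≤ {zero}  f≤g = ≤-refl
  sum-mono-≤ {suc n} f≤g = +-mono-≤ (f≤g zero) (sum-mono-≤ (f≤g ∘ suc))

  sum-nonneg≈0 : ∀ {n} {f : Vector Carrier n} → (∀ i → 0# ≤ f i) → sum f ≈ 0# → ∀ i → f i ≈ 0#
  sum-nonneg≈0 {suc n} {f} 0≤f Σ≈0 = λ where
      zero    → f₀≈0
      (suc i) → sum-nonneg≈0 (0≤f ∘ suc) (trans (sym (trans (+-congʳ f₀≈0) (+-identityˡ _))) Σ≈0) i
    where
    f₀≈0 : f zero ≈ 0#
    f₀≈0 = ≤-antisym
      (≤-respʳ-≈ Σ≈0 (≤-respˡ-≈ (+-identityʳ _) (+-mono-≤ ≤-refl (sum-nonneg (0≤f ∘ suc)))))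
      (0≤f zero)

  -- The inner product on ℝ^n

  infixl 6 _+ᵥ_ _-ᵥ_
  infixr 7 _•_

  _+ᵥ_ _-ᵥ_ : ∀ {n} → ℝ^ n → ℝ^ n → ℝ^ n
  (u +ᵥ v) i = u i + v i
  (u -ᵥ v) i = u i - v i

  _•_ : ∀ {n} → Carrier → ℝ^ n → ℝ^ n
  (x • u) i = x * u i

  module _ {n : ℕ} where

    ∙-cong : {u u′ v v′ : ℝ^ n} → u ≋ u′ → v ≋ v′ → u ∙ v ≈ u′ ∙ v′
    ∙-cong u≋u′ v≋v′ = sum-cong-≋ λ i → *-cong (u≋u′ i) (v≋v′ i)

    ∙-congˡ : (u : ℝ^ n) {v v′ : ℝ^ n} → v ≋ v′ → u ∙ v ≈ u ∙ v′
    ∙-congˡ u = ∙-cong {u} λ _ → refl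

    ∙-congʳ : (v : ℝ^ n) {u u′ : ℝ^ n} → u ≋ u′ → u ∙ v ≈ u′ ∙ v
    ∙-congʳ v u≋u′ = ∙-cong {v = v} u≋u′ λ _ → refl

    ∙-comm : (u v : ℝ^ n) → u ∙ v ≈ v ∙ u
    ∙-comm u v = sum-cong-≋ λ i → *-comm (u i) (v i)

    ∙-+ˡ : (u v w : ℝ^ n) → (u +ᵥ v) ∙ w ≈ u ∙ w + v ∙ w
    ∙-+ˡ u v w = trans
      (sum-cong-≋ λ i → solve 3 (λ u v w → (u :+ v) :* w := u :* w :+ v :* w) refl (u i) (v i) (w i))
      (∑-distrib-+ (λ i → u i * w i) (λ i → v i * w i))

    ∙-•ˡ : ∀ x (u w : ℝ^ n) → (x • u) ∙ w ≈ x * u ∙ w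
    ∙-•ˡ x u w = trans
      (sum-cong-≋ λ i → solve 3 (λ x u w → (x :* u) :* w := x :* (u :* w)) refl x (u i) (w i))
      (sym (*-distribˡ-sum x (λ i → u i * w i)))

    ∙--ˡ : (u v w : ℝ^ n) → (u -ᵥ v) ∙ w ≈ u ∙ w - v ∙ w
    ∙--ˡ u v w = begin
      (u -ᵥ v) ∙ w              ≈⟨ ∙-congʳ w (λ i → solve 2 (λ u v → u :- v := u :+ (:- con (+ 1)) :* v)
           refl (u i) (v i)) ⟩
      (u +ᵥ - 1# • v) ∙ w       ≈⟨ trans (∙-+ˡ u (- 1# • v) w) (+-congˡ (∙-•ˡ (- 1#) v w)) ⟩
      u ∙ w + - 1# * v ∙ w      ≈⟨ solve 2 (λ x y → x :+ (:- con (+ 1)) :* y := x :- y) refl (u ∙ w) (v ∙ w) ⟩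
      u ∙ w - v ∙ w             ∎

    ∙-+ʳ : (u v w : ℝ^ n) → u ∙ (v +ᵥ w) ≈ u ∙ v + u ∙ w
    ∙-+ʳ u v w = trans (∙-comm u (v +ᵥ w)) (trans (∙-+ˡ v w u) (+-cong (∙-comm v u) (∙-comm w u)))

    ∙-•ʳ : ∀ x (u w : ℝ^ n) → u ∙ (x • w) ≈ x * u ∙ w
    ∙-•ʳ x u w = trans (∙-comm u (x • w)) (trans (∙-•ˡ x w u) (*-congˡ (∙-comm w u)))

    ∙--ʳ : (u v w : ℝ^ n) → u ∙ (v -ᵥ w) ≈ u ∙ v - u ∙ w
    ∙--ʳ u v w = trans (∙-comm u (v -ᵥ w)) (trans (∙--ˡ v w u) (+-cong (∙-comm v u) (-‿cong (∙-comm w u))))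

    ∙-zeroˡ : (v : ℝ^ n) {u : ℝ^ n} → u ≋ 0ᵥ → u ∙ v ≈ 0#
    ∙-zeroˡ v u≋0 = sum-zero λ i → trans (*-congʳ (u≋0 i)) (zeroˡ (v i))

    ∙-zeroʳ : (u : ℝ^ n) {v : ℝ^ n} → v ≋ 0ᵥ → u ∙ v ≈ 0#
    ∙-zeroʳ u {v} v≋0 = trans (∙-comm u v) (∙-zeroˡ u v≋0)

    ∙-sumᵥˡ : ∀ {m} (vs : Vector (ℝ^ n) m) w → sumᵥ vs ∙ w ≈ sum λ j → vs j ∙ w
    ∙-sumᵥˡ {zero}  vs w = ∙-zeroˡ w (λ _ → refl)
    ∙-sumᵥˡ {suc m} vs w = trans (∙-+ˡ (vs zero) (sumᵥ (vs ∘ suc)) w) (+-congˡ (∙-sumᵥˡ (vs ∘ suc) w))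

    norm-nonneg : (u : ℝ^ n) → 0# ≤ u ∙ u
    norm-nonneg u = sum-nonneg λ i → square-nonneg (u i)

    norm≈0⇒≋0 : {u : ℝ^ n} → u ∙ u ≈ 0# → u ≋ 0ᵥ
    norm≈0⇒≋0 {u} u∙u≈0 i = square≈0 (sum-nonneg≈0 (λ i → square-nonneg (u i)) u∙u≈0 i)

    norm-pos : {u : ℝ^ n} → ¬ (u ≋ 0ᵥ) → 0# < u ∙ u
    norm-pos {u} u≄0 = nonneg∧≉0⇒pos (norm-nonneg u) (u≄0 ∘ norm≈0⇒≋0)

    -ᵥ-≋0 : {u v : ℝ^ n} → u -ᵥ v ≋ 0ᵥ → u ≋ v
    -ᵥ-≋0 u-v≋0 i = x-y≈0⇒x≈y (u-v≋0 i)

    -- Testing with w = u - v makes the squared norm of the difference vanish.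
    ∙-separates : {u v : ℝ^ n} → (∀ w → u ∙ w ≈ v ∙ w) → u ≋ v
    ∙-separates {u} {v} eq = -ᵥ-≋0 (norm≈0⇒≋0 (trans (∙--ˡ u v (u -ᵥ v)) (x≈y⇒x-y≈0 (eq (u -ᵥ v)))))

    -- The parallelogram law with the square of u - v dropped. The factor 2 is the price for a bound
    -- without mixed terms.
    norm-+≤ : (u v : ℝ^ n) →
              (u +ᵥ v) ∙ (u +ᵥ v) ≤ (u ∙ u + u ∙ u) + (v ∙ v + v ∙ v)
    norm-+≤ u v = 0≤y-x⇒x≤y (≤-respʳ-≈ eq (norm-nonneg (u -ᵥ v)))
      where
      eq : (u -ᵥ v) ∙ (u -ᵥ v) ≈ (u ∙ u + u ∙ u) + (v ∙ v + v ∙ v) - (u +ᵥ v) ∙ (u +ᵥ v)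
      eq = begin
        (u -ᵥ v) ∙ (u -ᵥ v)
          ≈⟨ trans (∙--ˡ u v _) (+-cong (∙--ʳ u u v) (-‿cong (∙--ʳ v u v))) ⟩
        u ∙ u - u ∙ v - (v ∙ u - v ∙ v)
          ≈⟨ solve 4 (λ a b c d → a :- b :- (c :- d) := (a :+ a) :+ (d :+ d) :- ((a :+ b) :+ (c :+ d)))
               refl (u ∙ u) (u ∙ v) (v ∙ u) (v ∙ v) ⟩
        (u ∙ u + u ∙ u) + (v ∙ v + v ∙ v) - ((u ∙ u + u ∙ v) + (v ∙ u + v ∙ v))
          ≈⟨ +-congˡ (-‿cong (trans (∙-+ˡ u v _) (+-cong (∙-+ʳ u u v) (∙-+ʳ v u v)))) ⟨
        (u ∙ u + u ∙ u) + (v ∙ v + v ∙ v) - (u +ᵥ v) ∙ (u +ᵥ v)  ∎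

    -- Expand the squared norm of (w ∙ w) a - (a ∙ w) w, a multiple of the part of a orthogonal to w
    -- that needs no division. One factor w ∙ w is then cancelled, so w = 0 is treated apart.
    cauchy-schwarz : (a w : ℝ^ n) → a ∙ w * (a ∙ w) ≤ a ∙ a * (w ∙ w)
    cauchy-schwarz a w with (w ∙ w) ≈? 0#
    ... | yes s≈0 = inj₂ (trans (*-congˡ (∙-zeroʳ a w≋0)) (trans (zeroʳ _)
                      (sym (trans (*-congˡ s≈0) (zeroʳ _)))))
      where
      w≋0 : w ≋ 0ᵥ
      w≋0 = norm≈0⇒≋0 s≈0
    ... | no  s≉0 = *-cancelˡ-≤ 0<s (0≤y-x⇒x≤y (≤-respʳ-≈ eq (norm-nonneg (s • a -ᵥ b • w))))
      where
      s b : Carrier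
      s = w ∙ w
      b = a ∙ w
      0<s : 0# < s
      0<s = nonneg∧≉0⇒pos (norm-nonneg w) s≉0
      eq : (s • a -ᵥ b • w) ∙ (s • a -ᵥ b • w) ≈ s * (a ∙ a * s) - s * (b * b)
      eq = begin
        (s • a -ᵥ b • w) ∙ (s • a -ᵥ b • w)
          ≈⟨ trans (∙--ˡ (s • a) (b • w) _) (+-cong (∙--ʳ (s • a) (s • a) (b • w)) (-‿cong (∙--ʳ (b • w) (s • a) (b • w)))) ⟩
        (s • a) ∙ (s • a) - (s • a) ∙ (b • w) - ((b • w) ∙ (s • a) - (b • w) ∙ (b • w))
          ≈⟨ +-cong (+-cong (•∙• s a s a) (-‿cong (•∙• s a b w))) (-‿cong (+-cong (•∙• b w s a) (-‿cong (•∙• b w b w)))) ⟩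
        s * (s * a ∙ a) - s * (b * b) - (b * (s * w ∙ a) - b * (b * s))
          ≈⟨ +-congˡ (-‿cong (+-congʳ (*-congˡ (*-congˡ (∙-comm w a))))) ⟩
        s * (s * a ∙ a) - s * (b * b) - (b * (s * b) - b * (b * s))
          ≈⟨ solve 3 (λ s q b → s :* (s :* q) :- s :* (b :* b) :- (b :* (s :* b) :- b :* (b :* s)) := s :* (q :* s) :- s :* (b :* b))
               refl s (a ∙ a) b ⟩
        s * (a ∙ a * s) - s * (b * b)  ∎
        where
        •∙• : ∀ x u y v → (x • u) ∙ (y • v) ≈ x * (y * u ∙ v)
        •∙• x u y v = trans (∙-•ˡ x u (y • v)) (*-congˡ (∙-•ʳ y u v))

    -- Trichotomy decides each coordinate. Every later case split on a zero vector, and every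
    -- argument by contradiction about one, rests on this.
    _≋0? : (u : ℝ^ n) → Dec (u ≋ 0ᵥ)
    u ≋0? = Fin.all? λ i → u i ≈? 0#

-- Self-adjoint operators and semidefinite forms on finite spans

module SelfAdjointOperators
  {c ℓ₁ ℓ₂ : Level} (ℝ : CompleteOrderedField c ℓ₁ ℓ₂) (n : ℕ) where

  open OrderedFieldProperties ℝ

  Operator : Set c
  Operator = ℝ^ n → ℝ^ n

  -- Adjointness alone forces extensionality and linearity, since the inner
  -- product separates vectors.
  SelfAdjoint : Operator → Set (c ⊔ ℓ₁)
  SelfAdjoint T = ∀ u v → T u ∙ v ≈ u ∙ T v

  -- Supplies the upper bound of the Rayleigh quotients that `complete` asks for.
  BoundedAbove : Operator → Set (c ⊔ ℓ₁ ⊔ ℓ₂)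
  BoundedAbove T = ∃ λ C → ∀ w → w ∙ T w ≤ C * (w ∙ w)

  module Linearity {T : Operator} (adj : SelfAdjoint T) where

    T-cong : ∀ {u v} → u ≋ v → T u ≋ T v
    T-cong {u} {v} u≋v = ∙-separates λ w → trans (adj u w) (trans (∙-congʳ (T w) u≋v) (sym (adj v w)))

    T-+ : ∀ u v → T (u +ᵥ v) ≋ T u +ᵥ T v
    T-+ u v = ∙-separates λ w → begin
      T (u +ᵥ v) ∙ w         ≈⟨ adj (u +ᵥ v) w ⟩
      (u +ᵥ v) ∙ T w         ≈⟨ ∙-+ˡ u v (T w) ⟩
      u ∙ T w + v ∙ T w      ≈⟨ +-cong (adj u w) (adj v w) ⟨
      T u ∙ w + T v ∙ w      ≈⟨ ∙-+ˡ (T u) (T v) w ⟨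
      (T u +ᵥ T v) ∙ w       ∎

    T-• : ∀ x u → T (x • u) ≋ x • T u
    T-• x u = ∙-separates λ w → begin
      T (x • u) ∙ w   ≈⟨ adj (x • u) w ⟩
      (x • u) ∙ T w   ≈⟨ ∙-•ˡ x u (T w) ⟩
      x * u ∙ T w     ≈⟨ *-congˡ (adj u w) ⟨
      x * T u ∙ w     ≈⟨ ∙-•ˡ x (T u) w ⟨
      (x • T u) ∙ w   ∎

    T-- : ∀ u v → T (u -ᵥ v) ≋ T u -ᵥ T v
    T-- u v = ∙-separates λ w → begin
      T (u -ᵥ v) ∙ w         ≈⟨ adj (u -ᵥ v) w ⟩
      (u -ᵥ v) ∙ T w         ≈⟨ ∙--ˡ u v (T w) ⟩
      u ∙ T w - v ∙ T w      ≈⟨ +-cong (adj u w) (-‿cong (adj v w)) ⟨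
      T u ∙ w - T v ∙ w      ≈⟨ ∙--ˡ (T u) (T v) w ⟨
      (T u -ᵥ T v) ∙ w       ∎

    T-0 : ∀ {u} → u ≋ 0ᵥ → T u ≋ 0ᵥ
    T-0 {u} u≋0 = ∙-separates λ w →
      trans (adj u w) (trans (∙-zeroˡ (T w) u≋0) (sym (∙-zeroˡ w λ _ → refl)))

  -- Linear combinations built one term at a time, without a coefficient vector: generators may
  -- recur in any order, and closure properties become inductions. The equation in each constructor
  -- makes membership respect `_≋_`.
  data Span {m : ℕ} (a : Vector (ℝ^ n) m) : Pred (ℝ^ n) (c ⊔ ℓ₁) where
    null : ∀ {w} → w ≋ 0ᵥ → Span a w
    plus : ∀ {u w} j y → Span a u → w ≋ y • a j +ᵥ u → Span a w

  module _ {m : ℕ} {a : Vector (ℝ^ n) m} where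

    Span-resp : ∀ {u w} → w ≋ u → Span a u → Span a w
    Span-resp w≋u (null u≋0)       = null λ i → trans (w≋u i) (u≋0 i)
    Span-resp w≋u (plus j y s u≋)  = plus j y s λ i → trans (w≋u i) (u≋ i)

    Span-mem : ∀ j → Span a (a j)
    Span-mem j = plus j 1# (null λ _ → refl) λ i → sym (trans (+-identityʳ _) (*-identityˡ _))

    Span-+ : ∀ {u v} → Span a u → Span a v → Span a (u +ᵥ v)
    Span-+ {u} {v} (null u≋0) sv = Span-resp (λ i → trans (+-congʳ (u≋0 i)) (+-identityˡ (v i))) sv
    Span-+ {u} {v} (plus {u′} j y s u≋) sv = plus j y (Span-+ s sv) λ i → begin
      u i + v i                   ≈⟨ +-congʳ (u≋ i) ⟩
      y * a j i + u′ i + v i      ≈⟨ solve 3 (λ x y z → x :+ y :+ z := x :+ (y :+ z)) refl _ _ _ ⟩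
      y * a j i + (u′ i + v i)    ∎

    Span-• : ∀ {u} x → Span a u → Span a (x • u)
    Span-• x (null u≋0) = null λ i → trans (*-congˡ (u≋0 i)) (zeroʳ x)
    Span-• x (plus {u′} j y s u≋) = plus j (x * y) (Span-• x s) λ i → trans (*-congˡ (u≋ i))
      (solve 4 (λ x y p q → x :* (y :* p :+ q) := x :* y :* p :+ x :* q) refl x y (a j i) (u′ i))

    Span-- : ∀ {u v} → Span a u → Span a v → Span a (u -ᵥ v)
    Span-- {u} {v} su sv = Span-resp
      (λ i → solve 2 (λ u v → u :- v := u :+ (:- con (+ 1)) :* v) refl (u i) (v i))
      (Span-+ su (Span-• (- 1#) sv))

    Span-⟂ : ∀ {v} → (∀ j → a j ∙ v ≈ 0#) → ∀ {w} → Span a w → w ∙ v ≈ 0#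
    Span-⟂ {v} a⟂v (null w≋0) = ∙-zeroˡ v w≋0
    Span-⟂ {v} a⟂v {w} (plus {u} j y s w≋) = begin
      w ∙ v                   ≈⟨ ∙-congʳ v w≋ ⟩
      (y • a j +ᵥ u) ∙ v      ≈⟨ trans (∙-+ˡ (y • a j) u v) (+-cong (∙-•ˡ y (a j) v) (Span-⟂ a⟂v s)) ⟩
      y * a j ∙ v + 0#        ≈⟨ trans (+-identityʳ _) (*-congˡ (a⟂v j)) ⟩
      y * 0#                  ≈⟨ zeroʳ y ⟩
      0#                      ∎

  Span-⊆ : ∀ {l m} {a : Vector (ℝ^ n) l} {b : Vector (ℝ^ n) m} →
           (∀ j → Span b (a j)) → ∀ {w} → Span a w → Span b w
  Span-⊆ a⊆b (null w≋0)      = null w≋0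
  Span-⊆ a⊆b (plus j y s w≋) = Span-resp w≋ (Span-+ (Span-• y (a⊆b j)) (Span-⊆ a⊆b s))

  -- For the form `u ∙ N v` on the span, `Degenerate` gives a nonzero vector of its radical.
  -- `Coercive` is the usual lower bound with the constant on the other side, which admits K = 0 for
  -- the span of no vectors.
  Degenerate Coercive : Operator → ∀ {m} → Vector (ℝ^ n) m → Set (c ⊔ ℓ₁ ⊔ ℓ₂)
  Degenerate N a = ∃ λ w → Span a w × 0# < w ∙ w × (∀ j → a j ∙ N w ≈ 0#)
  Coercive   N a = ∃ λ K → 0# ≤ K × (∀ {w} → Span a w → w ∙ w ≤ K * (w ∙ N w))

  -- Along v + t u the form is affine in t, because its quadratic coefficient u ∙ N u vanishes.
  -- Being nonnegative for every t, it has slope 2 (v ∙ N u) = 0.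
  isotropic⇒⟂ :
    ∀ {N} → SelfAdjoint N → ∀ {m} {a : Vector (ℝ^ n) m} →
    (∀ {w} → Span a w → 0# ≤ w ∙ N w) →
    ∀ {u} → Span a u → u ∙ N u ≈ 0# → ∀ {v} → Span a v → v ∙ N u ≈ 0#
  isotropic⇒⟂ {N} adj psd {u} su s≈0 {v} sv = x+x≈0⇒x≈0
    (affine-nonneg⇒slope≈0 λ t → ≤-respʳ-≈ (quadratic t) (psd (Span-+ sv (Span-• t su))))
    where
    open Linearity adj
    quadratic : ∀ t → (v +ᵥ t • u) ∙ N (v +ᵥ t • u) ≈ v ∙ N v + t * (v ∙ N u + v ∙ N u)
    quadratic t = begin
      (v +ᵥ t • u) ∙ N (v +ᵥ t • u)
        ≈⟨ ∙-congˡ _ (λ i → trans (T-+ v (t • u) i) (+-congˡ (T-• t u i))) ⟩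
      (v +ᵥ t • u) ∙ (N v +ᵥ t • N u)
        ≈⟨ trans (∙-+ˡ v (t • u) _) (+-cong (∙-+ʳ v _ _) (trans (∙-•ˡ t u _) (*-congˡ (∙-+ʳ u _ _)))) ⟩
      (v ∙ N v + v ∙ (t • N u)) + t * (u ∙ N v + u ∙ (t • N u))
        ≈⟨ +-cong (+-congˡ (∙-•ʳ t v (N u))) (*-congˡ (+-cong (trans (sym (adj u v)) (∙-comm (N u) v))
             (trans (∙-•ʳ t u (N u)) (*-congˡ s≈0)))) ⟩
      (v ∙ N v + t * v ∙ N u) + t * (v ∙ N u + t * 0#)
        ≈⟨ solve 3 (λ q t y → q :+ t :* y :+ t :* (y :+ t :* con (+ 0)) := q :+ t :* (y :+ y)) refl _ t _ ⟩
      v ∙ N v + t * (v ∙ N u + v ∙ N u)  ∎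

  -- Gram–Schmidt with respect to the semi-inner product u ∙ N v.
  degenerate-or-coercive :
    ∀ {N} → SelfAdjoint N → ∀ {m} (a : Vector (ℝ^ n) m) →
    (∀ {w} → Span a w → 0# ≤ w ∙ N w) → Degenerate N a ⊎ Coercive N a
  degenerate-or-coercive {N} adj {zero} a psd = inj₂ (0# , ≤-refl , bound)
    where
    bound : ∀ {w} → Span a w → w ∙ w ≤ 0# * (w ∙ N w)
    bound {w} (null w≋0) = inj₂ (trans (∙-zeroˡ w w≋0) (sym (zeroˡ _)))
  degenerate-or-coercive {N} adj {suc m} a psd with (a zero ∙ N (a zero)) ≈? 0# | a zero ≋0?
  -- A nonzero isotropic vector already lies in the radical.
  ... | yes s≈0 | no a₀≄0 = inj₁
    (a zero , Span-mem zero , norm-pos a₀≄0 , λ j → isotropic⇒⟂ adj psd (Span-mem zero) s≈0 (Span-mem j))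
  ... | yes s≈0 | yes a₀≋0 with degenerate-or-coercive adj (tail a) (psd ∘ Span-⊆ (Span-mem ∘ suc))
  ...   | inj₁ (w , sw , 0<w , ⟂) = inj₁ (w , Span-⊆ (Span-mem ∘ suc) sw , 0<w , λ where
            zero    → ∙-zeroˡ (N w) a₀≋0
            (suc j) → ⟂ j)
  ...   | inj₂ (K , 0≤K , bound) = inj₂ (K , 0≤K , bound ∘ Span-⊆ λ where
            zero    → null a₀≋0
            (suc j) → Span-mem j)
  degenerate-or-coercive {N} adj {suc m} a psd | no s≉0 | _ =
    lift (degenerate-or-coercive adj a′ (psd ∘ Span-⊆ a′⊆a))
    where
    open Linearity adj

    a₀ : ℝ^ n
    a₀ = a zero

    s q₀ : Carrier
    s  = a₀ ∙ N a₀
    q₀ = a₀ ∙ a₀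

    0<s : 0# < s
    0<s = nonneg∧≉0⇒pos (psd (Span-mem zero)) s≉0

    coef : Fin m → Carrier
    coef j = a (suc j) ∙ N a₀ * s ⁻¹

    a′ : Vector (ℝ^ n) m
    a′ j = a (suc j) -ᵥ coef j • a₀

    a′⊆a : ∀ j → Span a (a′ j)
    a′⊆a j = Span-- (Span-mem (suc j)) (Span-• (coef j) (Span-mem zero))

    a′⟂Na₀ : ∀ j → a′ j ∙ N a₀ ≈ 0#
    a′⟂Na₀ j = begin
      a′ j ∙ N a₀                   ≈⟨ trans (∙--ˡ (a (suc j)) (coef j • a₀) (N a₀)) (+-congˡ (-‿cong (∙-•ˡ (coef j) a₀ (N a₀)))) ⟩
      b - b * s ⁻¹ * s              ≈⟨ solve 3 (λ b i s → b :- b :* i :* s := b :- b :* (i :* s)) refl b (s ⁻¹) s ⟩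
      b - b * (s ⁻¹ * s)            ≈⟨ +-congˡ (-‿cong (*-congˡ (*-inverseˡ s s≉0))) ⟩
      b - b * 1#                    ≈⟨ solve 1 (λ b → b :- b :* con (+ 1) := con (+ 0)) refl b ⟩
      0#                            ∎
      where
      b : Carrier
      b = a (suc j) ∙ N a₀

    decompose : ∀ {w} → Span a w → ∃₂ λ y u → Span a′ u × w ≋ y • a₀ +ᵥ u
    decompose {w} (null w≋0) = 0# , 0ᵥ , null (λ _ → refl) , λ i →
      trans (w≋0 i) (solve 1 (λ x → con (+ 0) := con (+ 0) :* x :+ con (+ 0)) refl (a₀ i))
    decompose {w} (plus {v} j y sv w≋) with decompose sv
    decompose {w} (plus {v} zero y sv w≋) | z , u , su , v≋ = y + z , u , su , λ i →
      trans (w≋ i) (trans (+-congˡ (v≋ i))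
        (solve 4 (λ y z a u → y :* a :+ (z :* a :+ u) := (y :+ z) :* a :+ u) refl y z (a₀ i) (u i)))
    decompose {w} (plus {v} (suc j) y sv w≋) | z , u , su , v≋ =
      y * coef j + z , y • a′ j +ᵥ u , plus j y su (λ _ → refl) , λ i →
      trans (w≋ i) (trans (+-congˡ (v≋ i))
        (solve 6 (λ y z a b k u → y :* b :+ (z :* a :+ u) := (y :* k :+ z) :* a :+ (y :* (b :- k :* a) :+ u))
          refl y z (a₀ i) (a (suc j) i) (coef j) (u i)))

    lift : Degenerate N a′ ⊎ Coercive N a′ → Degenerate N a ⊎ Coercive N a
    lift (inj₁ (w , sw , 0<w , ⟂)) = inj₁ (w , Span-⊆ a′⊆a sw , 0<w , ⟂′)
      where
      -- A radical vector w of the smaller span stays one for the larger: w is a combination of the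
      -- `a′ j`, which are N-orthogonal to a₀, and each `a (suc j)` differs from `a′ j` by a
      -- multiple of a₀.
      a₀⟂Nw : a₀ ∙ N w ≈ 0#
      a₀⟂Nw = trans (sym (adj a₀ w)) (trans (∙-comm (N a₀) w) (Span-⟂ a′⟂Na₀ sw))

      ⟂′ : ∀ j → a j ∙ N w ≈ 0#
      ⟂′ zero    = a₀⟂Nw
      ⟂′ (suc j) = begin
        a (suc j) ∙ N w
          ≈⟨ solve 2 (λ x y → x := x :- y :+ y) refl _ (coef j * a₀ ∙ N w) ⟩
        a (suc j) ∙ N w - coef j * a₀ ∙ N w + coef j * a₀ ∙ N w
          ≈⟨ +-cong (trans (∙--ˡ (a (suc j)) (coef j • a₀) (N w)) (+-congˡ (-‿cong (∙-•ˡ (coef j) a₀ (N w))))) (*-congˡ (sym a₀⟂Nw)) ⟨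
        a′ j ∙ N w + coef j * 0#
          ≈⟨ trans (+-cong (⟂ j) (zeroʳ (coef j))) (+-identityˡ 0#) ⟩
        0#  ∎
    lift (inj₂ (K′ , 0≤K′ , bound′)) = inj₂ (K , 0≤K , bound)
      where
      -- For w = y a₀ + u the form has the value y² s + r, while the squared norm is at most 2 q₀ y²
      -- + 2 K′ r. With D = 2 q₀ / s, the sum K = D + 2 K′ dominates both coefficients.
      D K : Carrier
      D = (q₀ + q₀) * s ⁻¹
      K = D + (K′ + K′)

      0≤D : 0# ≤ D
      0≤D = *-nonneg (+-nonneg (norm-nonneg a₀) (norm-nonneg a₀)) (inj₁ (⁻¹-pos 0<s))

      0≤K : 0# ≤ K
      0≤K = +-nonneg 0≤D (+-nonneg 0≤K′ 0≤K′)

      Ds≈2q₀ : D * s ≈ q₀ + q₀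
      Ds≈2q₀ = begin
        (q₀ + q₀) * s ⁻¹ * s     ≈⟨ solve 3 (λ q i s → q :* i :* s := q :* (i :* s)) refl (q₀ + q₀) (s ⁻¹) s ⟩
        (q₀ + q₀) * (s ⁻¹ * s)   ≈⟨ *-congˡ (*-inverseˡ s s≉0) ⟩
        (q₀ + q₀) * 1#           ≈⟨ *-identityʳ _ ⟩
        q₀ + q₀                  ∎

      bound : ∀ {w} → Span a w → w ∙ w ≤ K * (w ∙ N w)
      bound {w} sw with decompose sw
      ... | y , u , su , w≋ = ≤-trans
        (≤-respˡ-≈ (∙-cong (λ i → sym (w≋ i)) (λ i → sym (w≋ i))) (norm-+≤ (y • a₀) u))
        (≤-trans (+-mono-≤ (inj₂ norm-ya₀) (+-mono-≤ (bound′ su) (bound′ su)))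
          (≤-respʳ-≈ (*-congˡ (sym energy)) (0≤y-x⇒x≤y (≤-respʳ-≈ gap
            (+-nonneg (*-nonneg 0≤D 0≤r) (*-nonneg (+-nonneg 0≤K′ 0≤K′) (*-nonneg (square-nonneg y) (inj₁ 0<s))))))))
        where
        r : Carrier
        r = u ∙ N u

        0≤r : 0# ≤ r
        0≤r = psd (Span-⊆ a′⊆a su)

        norm-ya₀ : (y • a₀) ∙ (y • a₀) + (y • a₀) ∙ (y • a₀) ≈ y * y * (q₀ + q₀)
        norm-ya₀ = trans (+-cong sq sq) (solve 2 (λ y q → y :* (y :* q) :+ y :* (y :* q) := y :* y :* (q :+ q)) refl y q₀)
          where
          sq : (y • a₀) ∙ (y • a₀) ≈ y * (y * q₀)
          sq = trans (∙-•ˡ y a₀ _) (*-congˡ (∙-•ʳ y a₀ a₀))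

        u⟂Na₀ : u ∙ N a₀ ≈ 0#
        u⟂Na₀ = Span-⟂ a′⟂Na₀ su

        energy : w ∙ N w ≈ y * y * s + r
        energy = begin
          w ∙ N w
            ≈⟨ ∙-cong w≋ (λ i → trans (T-cong w≋ i) (trans (T-+ (y • a₀) u i) (+-congʳ (T-• y a₀ i)))) ⟩
          (y • a₀ +ᵥ u) ∙ (y • N a₀ +ᵥ N u)
            ≈⟨ trans (∙-+ˡ (y • a₀) u _) (+-cong (trans (∙-•ˡ y a₀ _) (*-congˡ (∙-+ʳ a₀ _ _))) (∙-+ʳ u _ _)) ⟩
          y * (a₀ ∙ (y • N a₀) + a₀ ∙ N u) + (u ∙ (y • N a₀) + r)
            ≈⟨ +-cong (*-congˡ (+-cong (∙-•ʳ y a₀ (N a₀)) (trans (sym (adj a₀ u)) (trans (∙-comm (N a₀) u) u⟂Na₀))))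
                      (+-congʳ (trans (∙-•ʳ y u (N a₀)) (*-congˡ u⟂Na₀))) ⟩
          y * (y * s + 0#) + (y * 0# + r)
            ≈⟨ solve 3 (λ y s r → y :* (y :* s :+ con (+ 0)) :+ (y :* con (+ 0) :+ r) := y :* y :* s :+ r)
                 refl y s r ⟩
          y * y * s + r  ∎

        gap : D * r + (K′ + K′) * (y * y * s) ≈
              K * (y * y * s + r) - (y * y * (q₀ + q₀) + (K′ * r + K′ * r))
        gap = begin
          D * r + (K′ + K′) * (y * y * s)
            ≈⟨ solve 5 (λ D r k y s → D :* r :+ (k :+ k) :* (y :* y :* s) :=
                 (D :+ (k :+ k)) :* (y :* y :* s :+ r) :- (y :* y :* (D :* s) :+ (k :* r :+ k :* r))) refl D r K′ y s ⟩
          K * (y * y * s + r) - (y * y * (D * s) + (K′ * r + K′ * r))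
            ≈⟨ +-congˡ (-‿cong (+-congʳ (*-congˡ Ds≈2q₀))) ⟩
          K * (y * y * s + r) - (y * y * (q₀ + q₀) + (K′ * r + K′ * r))  ∎

-- The spectral theorem for a bounded self-adjoint operator

module SpectralTheorem
  {c ℓ₁ ℓ₂ : Level} (ℝ : CompleteOrderedField c ℓ₁ ℓ₂) (n : ℕ)
  {T : SelfAdjointOperators.Operator ℝ n}
  (adj : SelfAdjointOperators.SelfAdjoint ℝ n T)
  (bounded : SelfAdjointOperators.BoundedAbove ℝ n T)
  where

  open OrderedFieldProperties ℝ
  open SelfAdjointOperators ℝ n
  open Linearity adj

  Eigenvector : Carrier → Pred (ℝ^ n) ℓ₁
  Eigenvector μ w = T w ≋ μ • w

  T-sumᵥ : ∀ {m} (f : Vector (ℝ^ n) m) → T (sumᵥ f) ≋ sumᵥ (T ∘ f)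
  T-sumᵥ f = ∙-separates λ w → begin
    T (sumᵥ f) ∙ w            ≈⟨ adj (sumᵥ f) w ⟩
    sumᵥ f ∙ T w              ≈⟨ ∙-sumᵥˡ f (T w) ⟩
    sum (λ j → f j ∙ T w)     ≈⟨ sum-cong-≋ (λ j → adj (f j) w) ⟨
    sum (λ j → T (f j) ∙ w)   ≈⟨ ∙-sumᵥˡ (T ∘ f) w ⟨
    sumᵥ (T ∘ f) ∙ w          ∎

  eigenvectors-orthogonal : ∀ {μ ν u v} → ¬ (μ ≈ ν) → Eigenvector μ u → Eigenvector ν v → u ∙ v ≈ 0#
  eigenvectors-orthogonal {μ} {ν} {u} {v} μ≉ν Tu≋ Tv≋ = *-≈0 (μ≉ν ∘ x-y≈0⇒x≈y) (begin
    (μ - ν) * u ∙ v           ≈⟨ solve 3 (λ x y z → (x :- y) :* z := x :* z :- y :* z) refl μ ν (u ∙ v) ⟩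
    μ * u ∙ v - ν * u ∙ v     ≈⟨ x≈y⇒x-y≈0 swap ⟩
    0#                        ∎)
    where
    swap : μ * u ∙ v ≈ ν * u ∙ v
    swap = begin
      μ * u ∙ v        ≈⟨ ∙-•ˡ μ u v ⟨
      (μ • u) ∙ v      ≈⟨ ∙-congʳ v Tu≋ ⟨
      T u ∙ v          ≈⟨ adj u v ⟩
      u ∙ T v          ≈⟨ ∙-congˡ u Tv≋ ⟩
      u ∙ (ν • v)      ≈⟨ ∙-•ʳ ν u v ⟩
      ν * u ∙ v        ∎

  -- The sign, μ - T and not T - μ, makes the form semidefinite from above zero when μ is an upper
  -- bound of the Rayleigh quotients.
  char : Carrier → Operator
  char μ v = μ • v -ᵥ T v

  char-cong : ∀ μ {u v} → u ≋ v → char μ u ≋ char μ v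
  char-cong μ u≋v i = +-cong (*-congˡ (u≋v i)) (-‿cong (T-cong u≋v i))

  char-adj : ∀ μ → SelfAdjoint (char μ)
  char-adj μ u v = begin
    (μ • u -ᵥ T u) ∙ v      ≈⟨ trans (∙--ˡ (μ • u) (T u) v) (+-congʳ (∙-•ˡ μ u v)) ⟩
    μ * u ∙ v - T u ∙ v     ≈⟨ +-congˡ (-‿cong (adj u v)) ⟩
    μ * u ∙ v - u ∙ T v     ≈⟨ trans (∙--ʳ u (μ • v) (T v)) (+-congʳ (∙-•ʳ μ u v)) ⟨
    u ∙ (μ • v -ᵥ T v)      ∎

  char≋0⇒eigenvector : ∀ {μ w} → char μ w ≋ 0ᵥ → Eigenvector μ w
  char≋0⇒eigenvector eq i = sym (x-y≈0⇒x≈y (eq i))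

  eigenvector⇒char≋0 : ∀ {μ w} → Eigenvector μ w → char μ w ≋ 0ᵥ
  eigenvector⇒char≋0 eq i = x≈y⇒x-y≈0 (sym (eq i))

  Eigenvector-• : ∀ {μ w} x → Eigenvector μ w → Eigenvector μ (x • w)
  Eigenvector-• {μ} {w} x eq i = begin
    T (x • w) i      ≈⟨ T-• x w i ⟩
    x * T w i        ≈⟨ *-congˡ (eq i) ⟩
    x * (μ * w i)    ≈⟨ solve 3 (λ x y z → x :* (y :* z) := y :* (x :* z)) refl x μ (w i) ⟩
    μ * (x * w i)    ∎

  -- The supremum μ of the Rayleigh quotients on the span makes char μ positive
  -- semidefinite there; were it coercive, a smaller upper bound would exist.
  eigenvector-in-invariant-span :
    ∀ {m} {a : Vector (ℝ^ n) m} → (∀ {w} → Span a w → Span a (T w)) →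
    ∀ {u} → Span a u → ¬ (u ≋ 0ᵥ) →
    ∃₂ λ μ w → Span a w × 0# < w ∙ w × Eigenvector μ w
  eigenvector-in-invariant-span {a = a} invariant {u} su u≄0 =
    conclude (degenerate-or-coercive (char-adj μ) a psd)
    where
    -- All numbers below some Rayleigh quotient: they have the same supremum as the quotients and
    -- are described without division.
    Rayleigh : Pred Carrier (c ⊔ ℓ₁ ⊔ ℓ₂)
    Rayleigh r = ∃ λ w → Span a w × 0# < w ∙ w × r * (w ∙ w) ≤ w ∙ T w

    quotient : ∀ {w} → 0# < w ∙ w → w ∙ T w * (w ∙ w) ⁻¹ * (w ∙ w) ≈ w ∙ T w
    quotient {w} 0<s = begin
      w ∙ T w * (w ∙ w) ⁻¹ * (w ∙ w)     ≈⟨ solve 3 (λ x i s → x :* i :* s := x :* (i :* s)) refl (w ∙ T w) ((w ∙ w) ⁻¹) (w ∙ w) ⟩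
      w ∙ T w * ((w ∙ w) ⁻¹ * (w ∙ w))   ≈⟨ *-congˡ (*-inverseˡ (w ∙ w) (pos⇒≉0 0<s)) ⟩
      w ∙ T w * 1#                       ≈⟨ *-identityʳ _ ⟩
      w ∙ T w                            ∎

    rayleigh : ∀ {w} → Span a w → 0# < w ∙ w → Rayleigh (w ∙ T w * (w ∙ w) ⁻¹)
    rayleigh {w} sw 0<s = w , sw , 0<s , inj₂ (quotient 0<s)

    C : Carrier
    C = proj₁ bounded

    upper-bound : UpperBound Rayleigh C
    upper-bound r (w , _ , 0<s , rs≤) = *-cancelˡ-≤ 0<s
      (≤-respˡ-≈ (*-comm r (w ∙ w)) (≤-respʳ-≈ (*-comm C (w ∙ w)) (≤-trans rs≤ (proj₂ bounded w))))

    supremum : ∃ λ s → UpperBound Rayleigh s × (∀ b → UpperBound Rayleigh b → s ≤ b)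
    supremum = complete Rayleigh (u ∙ T u * (u ∙ u) ⁻¹ , rayleigh su (norm-pos u≄0)) (C , upper-bound)

    μ : Carrier
    μ = proj₁ supremum

    energy : ∀ w → w ∙ char μ w ≈ μ * (w ∙ w) - w ∙ T w
    energy w = trans (∙--ʳ w (μ • w) (T w)) (+-congʳ (∙-•ʳ μ w w))

    psd : ∀ {w} → Span a w → 0# ≤ w ∙ char μ w
    psd {w} sw = by-cases (w ≋0?)
      where
      by-cases : Dec (w ≋ 0ᵥ) → 0# ≤ w ∙ char μ w
      by-cases (yes w≋0) = inj₂ (sym (∙-zeroˡ (char μ w) w≋0))
      by-cases (no  w≄0) = ≤-respʳ-≈ (sym (energy w)) (x≤y⇒0≤y-x (≤-respˡ-≈ quotient′ bound))
        where
        s ρ : Carrier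
        s = w ∙ w
        ρ = w ∙ T w * s ⁻¹
        0<s : 0# < s
        0<s = norm-pos w≄0
        quotient′ : s * ρ ≈ w ∙ T w
        quotient′ = trans (*-comm s ρ) (quotient 0<s)
        bound : s * ρ ≤ μ * s
        bound = ≤-respʳ-≈ (*-comm s μ) (*-monoˡ-≤ (inj₁ 0<s) (proj₁ (proj₂ supremum) ρ (rayleigh sw 0<s)))

    conclude : Degenerate (char μ) a ⊎ Coercive (char μ) a →
               ∃₂ λ μ w → Span a w × 0# < w ∙ w × Eigenvector μ w
    -- By invariance `char μ w` lies in the span, and it is orthogonal to every generator; so it is
    -- orthogonal to itself.
    conclude (inj₁ (w , sw , 0<s , ⟂)) = μ , w , sw , 0<s ,
      char≋0⇒eigenvector (norm≈0⇒≋0 (Span-⟂ ⟂ (Span-- (Span-• μ sw) (invariant sw))))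
    conclude (inj₂ (K , 0≤K , coercive)) = contradiction
      (proj₂ (proj₂ supremum) (μ - δ) smaller-bound) (<⇒≱ (0<y-x⇒x<y
        (<-respʳ-≈ (solve 2 (λ m d → d := m :- (m :- d)) refl μ δ) 0<δ)))
      where
      0<K+1 : 0# < K + 1#
      0<K+1 = nonneg⇒0<x+1 0≤K

      -- For K > 0 coercivity bounds every quotient by μ - 1 / K. As K may be 0, 1 / (K + 1) takes
      -- the place of 1 / K.
      δ : Carrier
      δ = (K + 1#) ⁻¹

      0<δ : 0# < δ
      0<δ = ⁻¹-pos 0<K+1

      -- It suffices that 1 ≤ (K + 1) (μ - r). Multiplied by s this follows from s ≤ K e, where e =
      -- w ∙ char μ w, because the right side exceeds K e by e + (K + 1) (t - r s).
      smaller-bound : UpperBound Rayleigh (μ - δ)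
      smaller-bound r (w , sw , 0<s , rs≤) = 0≤y-x⇒x≤y (≤-respʳ-≈
        (solve 3 (λ m r d → m :- r :- d := m :- d :- r) refl μ r δ)
        (x≤y⇒0≤y-x (*-cancelˡ-≤ 0<K+1 (≤-respˡ-≈ (sym (*-inverseʳ (K + 1#) (pos⇒≉0 0<K+1)))
          (*-cancelˡ-≤ 0<s (≤-trans (≤-trans (inj₂ (*-identityʳ s)) (coercive sw))
            (0≤y-x⇒x≤y (≤-respʳ-≈ gap (+-nonneg (psd sw) (*-nonneg (inj₁ 0<K+1) (x≤y⇒0≤y-x rs≤)))))))))))
        where
        s t : Carrier
        s = w ∙ w
        t = w ∙ T w
        gap : w ∙ char μ w + (K + 1#) * (t - r * s) ≈
              s * ((K + 1#) * (μ - r)) - K * (w ∙ char μ w)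
        gap = begin
          w ∙ char μ w + (K + 1#) * (t - r * s)
            ≈⟨ +-congʳ (energy w) ⟩
          (μ * s - t) + (K + 1#) * (t - r * s)
            ≈⟨ solve 5 (λ m s t K r → (m :* s :- t) :+ (K :+ con (+ 1)) :* (t :- r :* s) :=
                 s :* ((K :+ con (+ 1)) :* (m :- r)) :- K :* (m :* s :- t)) refl μ s t K r ⟩
          s * ((K + 1#) * (μ - r)) - K * (μ * s - t)
            ≈⟨ +-congˡ (-‿cong (*-congˡ (energy w))) ⟨
          s * ((K + 1#) * (μ - r)) - K * (w ∙ char μ w)  ∎

  -- Images of self-adjoint operators that commute with T

  unit : Fin n → ℝ^ n
  unit j i = if does (j Fin.≟ i) then 1# else 0#

  unit-expansion : ∀ x → x ≋ sumᵥ (λ j → x j • unit j)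
  unit-expansion x i = sym (trans
    (sum-single i λ j j≢i → trans (*-congˡ (reflexive (≡.cong (if_then 1# else 0#) (dec-false (j Fin.≟ i) j≢i)))) (zeroʳ (x j)))
    (trans (*-congˡ (reflexive (≡.cong (if_then 1# else 0#) (dec-true (i Fin.≟ i) ≡.refl)))) (*-identityʳ (x i))))

  Span-sumᵥ : ∀ {m l} {a : Vector (ℝ^ n) m} (f : Vector (ℝ^ n) l) → (∀ j → Span a (f j)) → Span a (sumᵥ f)
  Span-sumᵥ {l = zero}  f sf = null λ _ → refl
  Span-sumᵥ {l = suc l} f sf = Span-+ (sf zero) (Span-sumᵥ (f ∘ suc) (sf ∘ suc))

  Commuting : Operator → Set (c ⊔ ℓ₁)
  Commuting A = ∀ v → T (A v) ≋ A (T v)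

  module Range {A : Operator} (A-adj : SelfAdjoint A) where

    open Linearity A-adj renaming (T-cong to A-cong; T-+ to A-+; T-• to A-•; T-0 to A-0) using ()

    -- The columns of A. They present the image of A as a finite span, the form in which
    -- `eigenvector-in-invariant-span` can be applied to it.
    range : Vector (ℝ^ n) n
    range j = A (unit j)

    Span-range : ∀ x → Span range (A x)
    Span-range x = image (Span-resp (unit-expansion x) (Span-sumᵥ _ λ j → Span-• (x j) (Span-mem j)))
      where
      image : ∀ {x} → Span unit x → Span range (A x)
      image (null x≋0) = null (A-0 x≋0)
      image (plus {u} j y s x≋) = plus j y (image s) λ i →
        trans (A-cong x≋ i) (trans (A-+ (y • unit j) u i) (+-congʳ (A-• y (unit j) i)))

    range-Span : ∀ {w} → Span range w → ∃ λ x → w ≋ A x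
    range-Span (null w≋0) = 0ᵥ , λ i → trans (w≋0 i) (sym (A-0 (λ _ → refl) i))
    range-Span (plus j y s w≋) with range-Span s
    ... | x , u≋ = y • unit j +ᵥ x , λ i → trans (w≋ i) (trans (+-congˡ (u≋ i))
          (sym (trans (A-+ (y • unit j) x i) (+-congʳ (A-• y (unit j) i)))))

    -- The image of A is invariant under T, so if it is nonzero it contains an eigenvector w = A x.
    -- Moving A across, w ∙ w = x ∙ A w = 0, a contradiction.
    kills-eigenvectors⇒≋0 :
      Commuting A → (∀ {μ w} → Eigenvector μ w → A w ≋ 0ᵥ) → ∀ v → A v ≋ 0ᵥ
    kills-eigenvectors⇒≋0 commutes kills v = decidable-stable (A v ≋0?) λ Av≄0 →
      no-eigenvector (eigenvector-in-invariant-span invariant (Span-range v) Av≄0)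
      where
      invariant : ∀ {w} → Span range w → Span range (T w)
      invariant sw = let x , w≋Ax = range-Span sw in
        Span-resp (λ i → trans (T-cong w≋Ax i) (commutes x i)) (Span-range (T x))

      no-eigenvector : ¬ (∃₂ λ μ w → Span range w × 0# < w ∙ w × Eigenvector μ w)
      no-eigenvector (μ , w , sw , 0<s , eig) = let x , w≋Ax = range-Span sw in
        pos⇒≉0 0<s (trans (∙-congʳ w w≋Ax) (trans (A-adj x w) (∙-zeroʳ x (kills eig))))

  open Range public using (kills-eigenvectors⇒≋0)

  -- Products of factors μ - T

  annihilator : ∀ {m} → Vector Carrier m → Operator
  annihilator {zero}  ev v = v
  annihilator {suc m} ev v = char (ev zero) (annihilator (tail ev) v)

  char-commutes : ∀ {A} → SelfAdjoint A → Commuting A → ∀ μ v → char μ (A v) ≋ A (char μ v)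
  char-commutes {A} A-adj commutes μ v i = begin
    μ * A v i - T (A v) i            ≈⟨ +-cong (sym (T-•′ μ v i)) (-‿cong (commutes v i)) ⟩
    A (μ • v) i - A (T v) i          ≈⟨ T--′ (μ • v) (T v) i ⟨
    A (μ • v -ᵥ T v) i               ∎
    where open Linearity A-adj renaming (T-• to T-•′; T-- to T--′) using ()

  annihilator-cong : ∀ {m} (ev : Vector Carrier m) {u v} → u ≋ v → annihilator ev u ≋ annihilator ev v
  annihilator-cong {zero}  ev u≋v = u≋v
  annihilator-cong {suc m} ev u≋v = char-cong (ev zero) (annihilator-cong (tail ev) u≋v)

  -- A is kept general because it is later T itself, a single factor `char μ`, and another product
  -- of factors.
  annihilator-commutes : ∀ {A} → SelfAdjoint A → Commuting A → ∀ {m} (ev : Vector Carrier m) v →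
                         annihilator ev (A v) ≋ A (annihilator ev v)
  annihilator-commutes A-adj commutes {zero}  ev v i = refl
  annihilator-commutes A-adj commutes {suc m} ev v i = trans
    (char-cong (ev zero) (annihilator-commutes A-adj commutes (tail ev) v) i)
    (char-commutes A-adj commutes (ev zero) (annihilator (tail ev) v) i)

  annihilator-Commuting : ∀ {m} (ev : Vector Carrier m) → Commuting (annihilator ev)
  annihilator-Commuting ev v i = sym (annihilator-commutes adj (λ _ _ → refl) ev v i)

  char-Commuting : ∀ μ → Commuting (char μ)
  char-Commuting μ v i = trans (T-- (μ • v) (T v) i) (+-congʳ (T-• μ v i))

  annihilator-char : ∀ {m} (ev : Vector Carrier m) μ v → annihilator ev (char μ v) ≋ char μ (annihilator ev v)
  annihilator-char ev μ = annihilator-commutes (char-adj μ) (char-Commuting μ) ev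

  annihilator-adj : ∀ {m} (ev : Vector Carrier m) → SelfAdjoint (annihilator ev)
  annihilator-adj {zero}  ev u v = refl
  annihilator-adj {suc m} ev u v = begin
    char (ev zero) (annihilator (tail ev) u) ∙ v     ≈⟨ char-adj (ev zero) _ v ⟩
    annihilator (tail ev) u ∙ char (ev zero) v       ≈⟨ annihilator-adj (tail ev) u _ ⟩
    u ∙ annihilator (tail ev) (char (ev zero) v)     ≈⟨ ∙-congˡ u (annihilator-char (tail ev) (ev zero) v) ⟩
    u ∙ char (ev zero) (annihilator (tail ev) v)     ∎

  annihilator-0 : ∀ {m} (ev : Vector Carrier m) {v} → v ≋ 0ᵥ → annihilator ev v ≋ 0ᵥ
  annihilator-0 ev = Linearity.T-0 (annihilator-adj ev)

  annihilator-eigenvector : ∀ {m} (ev : Vector Carrier m) {μ w} →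
                            Eigenvector μ w → Eigenvector μ (annihilator ev w)
  annihilator-eigenvector ev {μ} {w} eig i = begin
    T (annihilator ev w) i      ≈⟨ annihilator-Commuting ev w i ⟩
    annihilator ev (T w) i      ≈⟨ annihilator-cong ev eig i ⟩
    annihilator ev (μ • w) i    ≈⟨ Linearity.T-• (annihilator-adj ev) μ w i ⟩
    μ * annihilator ev w i      ∎

  annihilator-kills : ∀ {m} (ev : Vector Carrier m) {μ w} j → μ ≈ ev j →
                      Eigenvector μ w → annihilator ev w ≋ 0ᵥ
  annihilator-kills {suc m} ev zero μ≈ eig = eigenvector⇒char≋0 λ i →
    trans (annihilator-eigenvector (tail ev) eig i) (*-congʳ μ≈)
  annihilator-kills {suc m} ev (suc j) μ≈ eig =
    Linearity.T-0 (char-adj (ev zero)) (annihilator-kills (tail ev) j μ≈ eig)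

  -- Remove the outermost factor: z, the product of the others applied to u, is an eigenvector for
  -- `ev zero`, and these others map it to an eigenvector for the same value. So z ∙ z, which equals
  -- u paired with that image, vanishes, and the induction continues with one factor less.
  annihilated∧orthogonal⇒≋0 :
    ∀ {m} (ev : Vector Carrier m) {u} → annihilator ev u ≋ 0ᵥ →
    (∀ j {w} → Eigenvector (ev j) w → u ∙ w ≈ 0#) → u ≋ 0ᵥ
  annihilated∧orthogonal⇒≋0 {zero}  ev     u≋0 _ = u≋0
  annihilated∧orthogonal⇒≋0 {suc m} ev {u} pu≋0 ⟂ =
    annihilated∧orthogonal⇒≋0 (tail ev) (norm≈0⇒≋0 (begin
      z ∙ z                             ≈⟨ annihilator-adj (tail ev) u z ⟩
      u ∙ annihilator (tail ev) z       ≈⟨ ⟂ zero (annihilator-eigenvector (tail ev) (char≋0⇒eigenvector pu≋0)) ⟩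
      0#                                ∎))
      (⟂ ∘ suc)
    where
    z : ℝ^ n
    z = annihilator (tail ev) u

  -- Partial fractions. By induction `char (ev zero) g` is a sum of eigenvectors for the other
  -- values, on each of which `char (ev zero)` is multiplication by the nonzero `gap j`. Dividing by
  -- the gaps gives a second preimage, and g minus that preimage is an eigenvector for `ev zero`.
  annihilated⇒sum :
    ∀ {m} (ev : Vector Carrier m) → (∀ {i j} → i Fin.< j → ¬ (ev i ≈ ev j)) →
    ∀ {g} → annihilator ev g ≋ 0ᵥ →
    ∃ λ h → (∀ j → Eigenvector (ev j) (h j)) × g ≋ sumᵥ h
  annihilated⇒sum {zero}  ev distinct g≋0 = (λ ()) , (λ ()) , g≋0
  annihilated⇒sum {suc m} ev distinct {g} pg≋0 =
    h , eig , λ i → solve 2 (λ x y → x := x :- y :+ y) refl (g i) (sumᵥ tails i)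
    where
    rest : ∃ λ h → (∀ j → Eigenvector (ev (suc j)) (h j)) × char (ev zero) g ≋ sumᵥ h
    rest = annihilated⇒sum (tail ev) (distinct ∘ ℕ.s≤s)
      (λ i → trans (annihilator-char (tail ev) (ev zero) g i) (pg≋0 i))

    h′ : Vector (ℝ^ n) m
    h′ = proj₁ rest

    eig′ : ∀ j → Eigenvector (ev (suc j)) (h′ j)
    eig′ = proj₁ (proj₂ rest)

    eq′ : char (ev zero) g ≋ sumᵥ h′
    eq′ = proj₂ (proj₂ rest)

    gap : Fin m → Carrier
    gap j = ev zero - ev (suc j)

    gap≉0 : ∀ j → ¬ (gap j ≈ 0#)
    gap≉0 j = distinct {zero} {suc j} (ℕ.s≤s ℕ.z≤n) ∘ x-y≈0⇒x≈y

    tails : Vector (ℝ^ n) m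
    tails j = gap j ⁻¹ • h′ j

    tails-eig : ∀ j → Eigenvector (ev (suc j)) (tails j)
    tails-eig j = Eigenvector-• (gap j ⁻¹) (eig′ j)

    h : Vector (ℝ^ n) (suc m)
    h zero    = g -ᵥ sumᵥ tails
    h (suc j) = tails j

    char-tails : ∀ j → char (ev zero) (tails j) ≋ h′ j
    char-tails j i = begin
      ev zero * tails j i - T (tails j) i                 ≈⟨ +-congˡ (-‿cong (tails-eig j i)) ⟩
      ev zero * tails j i - ev (suc j) * tails j i        ≈⟨ solve 4 (λ a b k x → a :* (k :* x) :- b :* (k :* x) := (a :- b) :* k :* x) refl (ev zero) (ev (suc j)) (gap j ⁻¹) (h′ j i) ⟩
      gap j * gap j ⁻¹ * h′ j i                           ≈⟨ *-congʳ (*-inverseʳ (gap j) (gap≉0 j)) ⟩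
      1# * h′ j i                                         ≈⟨ *-identityˡ _ ⟩
      h′ j i                                              ∎

    char-sum : char (ev zero) (sumᵥ tails) ≋ char (ev zero) g
    char-sum i = begin
      ev zero * sumᵥ tails i - T (sumᵥ tails) i
        ≈⟨ solve 2 (λ x y → x :- y := x :+ (:- con (+ 1)) :* y) refl _ _ ⟩
      ev zero * sumᵥ tails i + - 1# * T (sumᵥ tails) i
        ≈⟨ +-cong (*-distribˡ-sum (ev zero) (λ j → tails j i)) (trans (*-congˡ (T-sumᵥ tails i)) (*-distribˡ-sum (- 1#) (λ j → T (tails j) i))) ⟩
      sum (λ j → ev zero * tails j i) + sum (λ j → - 1# * T (tails j) i)
        ≈⟨ ∑-distrib-+ (λ j → ev zero * tails j i) (λ j → - 1# * T (tails j) i) ⟨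
      sum (λ j → ev zero * tails j i + - 1# * T (tails j) i)
        ≈⟨ sum-cong-≋ (λ j → trans (solve 2 (λ x y → x :+ (:- con (+ 1)) :* y := x :- y)
             refl (ev zero * tails j i) (T (tails j) i)) (char-tails j i)) ⟩
      sumᵥ h′ i
        ≈⟨ eq′ i ⟨
      char (ev zero) g i  ∎

    eig : ∀ j → Eigenvector (ev j) (h j)
    eig zero = char≋0⇒eigenvector λ i → trans
      (Linearity.T-- (char-adj (ev zero)) g (sumᵥ tails) i) (x≈y⇒x-y≈0 (sym (char-sum i)))
    eig (suc j) = tails-eig j

  -- A₂ is self-adjoint and preserves every eigenspace, so A₂ g inherits the orthogonality of g.
  -- Since A₁ A₂ kills every eigenvector by exhaustiveness, it is 0 and A₁ kills A₂ g.
  orthogonal⇒sum-of-complementary :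
    ∀ {l m} (ev₁ : Vector Carrier l) (ev₂ : Vector Carrier m) →
    (∀ {i j} → i Fin.< j → ¬ (ev₂ i ≈ ev₂ j)) →
    (∀ {μ w} → ¬ (w ≋ 0ᵥ) → Eigenvector μ w → (∃ λ i → μ ≈ ev₁ i) ⊎ (∃ λ j → μ ≈ ev₂ j)) →
    ∀ {g} → (∀ i {w} → Eigenvector (ev₁ i) w → g ∙ w ≈ 0#) →
    ∃ λ h → (∀ j → Eigenvector (ev₂ j) (h j)) × g ≋ sumᵥ h
  orthogonal⇒sum-of-complementary ev₁ ev₂ distinct exhaustive {g} g⟂ =
    annihilated⇒sum ev₂ distinct (annihilated∧orthogonal⇒≋0 ev₁ (A≋0 g) λ i {w} eig →
      trans (annihilator-adj ev₂ g w) (g⟂ i (annihilator-eigenvector ev₂ eig)))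
    where
    A₁ A₂ A : Operator
    A₁ = annihilator ev₁
    A₂ = annihilator ev₂
    A  = A₁ ∘ A₂

    A-adj : SelfAdjoint A
    A-adj u v = begin
      A₁ (A₂ u) ∙ v     ≈⟨ annihilator-adj ev₁ (A₂ u) v ⟩
      A₂ u ∙ A₁ v       ≈⟨ annihilator-adj ev₂ u (A₁ v) ⟩
      u ∙ A₂ (A₁ v)     ≈⟨ ∙-congˡ u (annihilator-commutes (annihilator-adj ev₁) (annihilator-Commuting ev₁) ev₂ v) ⟩
      u ∙ A₁ (A₂ v)     ∎

    A-Commuting : Commuting A
    A-Commuting v i = trans (annihilator-Commuting ev₁ (A₂ v) i)
      (annihilator-cong ev₁ (annihilator-Commuting ev₂ v) i)

    kills : ∀ {μ w} → Eigenvector μ w → A w ≋ 0ᵥ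
    kills {μ} {w} eig with w ≋0?
    ... | yes w≋0 = annihilator-0 ev₁ (annihilator-0 ev₂ w≋0)
    ... | no  w≄0 with exhaustive w≄0 eig
    ...   | inj₁ (i , μ≈) = annihilator-kills ev₁ i μ≈ (annihilator-eigenvector ev₂ eig)
    ...   | inj₂ (j , μ≈) = annihilator-0 ev₁ (annihilator-kills ev₂ j μ≈ eig)

    A≋0 : ∀ v → A v ≋ 0ᵥ
    A≋0 = kills-eigenvectors⇒≋0 A-adj A-Commuting kills

-- Lower and upper eigenvalue indices; positions of rows in the stacked matrix

module _ {t k : ℕ} (t<k : t ℕ.< k) where

  toℕ-lower : ∀ i → toℕ (lower t<k i) ≡ toℕ i
  toℕ-lower i = Fin.toℕ-inject≤ i (ℕ.s≤s (ℕ.<⇒≤ t<k))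

  toℕ-upper : ∀ j → toℕ (upper t<k j) ≡ suc t ℕ.+ toℕ j
  toℕ-upper j = ≡.trans (Fin.toℕ-cast (≡.cong suc (ℕ.m+[n∸m]≡n (ℕ.<⇒≤ t<k))) (suc t ↑ʳ j)) (Fin.toℕ-↑ʳ (suc t) j)

  lower<upper : ∀ i j → lower t<k i Fin.< upper t<k j
  lower<upper i j = ≡.subst₂ ℕ._<_ (≡.sym (toℕ-lower i)) (≡.sym (toℕ-upper j))
    (ℕ.<-≤-trans (Fin.toℕ<n i) (ℕ.m≤m+n (suc t) (toℕ j)))

  upper-mono-< : ∀ {i j} → i Fin.< j → upper t<k i Fin.< upper t<k j
  upper-mono-< {i} {j} i<j = ≡.subst₂ ℕ._<_ (≡.sym (toℕ-upper i)) (≡.sym (toℕ-upper j))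
    (ℕ.+-monoʳ-< (suc t) i<j)

  lower-or-upper : ∀ i → (∃ λ l → i ≡ lower t<k l) ⊎ (∃ λ j → i ≡ upper t<k j)
  lower-or-upper i with toℕ i ℕ.<? suc t
  ... | yes i<1+t = inj₁ (fromℕ< i<1+t , Fin.toℕ-injective
          (≡.sym (≡.trans (toℕ-lower _) (Fin.toℕ-fromℕ< i<1+t))))
  ... | no  i≮1+t = inj₂ (fromℕ< below , Fin.toℕ-injective (≡.sym (≡.trans (toℕ-upper _)
          (≡.trans (≡.cong (suc t ℕ.+_) (Fin.toℕ-fromℕ< below)) (ℕ.m+[n∸m]≡n 1+t≤i)))))
    where
    1+t≤i : suc t ℕ.≤ toℕ i
    1+t≤i = ℕ.≮⇒≥ i≮1+t
    below : toℕ i ∸ suc t ℕ.< k ∸ t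
    below = ℕ.∸-monoˡ-< (Fin.toℕ<n i) 1+t≤i

-- The row of `stack d` that holds vector i of block j.
place : ∀ {m} (d : Vector ℕ m) j → Fin (d j) → Fin (sumℕ d)
place d zero    i = i ↑ˡ sumℕ (tail d)
place d (suc j) i = d zero ↑ʳ place (tail d) j i

place-surjective : ∀ {m} (d : Vector ℕ m) r → ∃₂ λ j i → place d j i ≡ r
place-surjective {suc m} d r with Fin.splitAt (d zero) r in eq
... | inj₁ i = zero , i , Fin.splitAt⁻¹-↑ˡ eq
... | inj₂ s with place-surjective (tail d) s
...   | j , i , ≡.refl = suc j , i , Fin.splitAt⁻¹-↑ʳ eq

stack-place : ∀ {a} {A : Set a} {m} (d : Vector ℕ m) (xs : ∀ j → Vector A (d j)) j i →
              stack d xs (place d j i) ≡ xs j i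
stack-place d xs zero    i = lookup-++ˡ (xs zero) _ i
stack-place d xs (suc j) i =
  ≡.trans (lookup-++ʳ (xs zero) _ (place (tail d) j i)) (stack-place (tail d) (λ j → xs (suc j)) j i)

-- Block sums and matrices as operators

module Matrices {c ℓ₁ ℓ₂ : Level} (ℝ : CompleteOrderedField c ℓ₁ ℓ₂) where

  open OrderedFieldProperties ℝ

  sum-+ : ∀ m {n} (f : Vector Carrier (m ℕ.+ n)) →
          sum f ≈ sum (λ i → f (i ↑ˡ n)) + sum (λ i → f (m ↑ʳ i))
  sum-+ zero    f = sym (+-identityˡ _)
  sum-+ (suc m) {n} f = trans (+-congˡ (sum-+ m (f ∘ suc)))
    (solve 3 (λ x y z → x :+ (y :+ z) := x :+ y :+ z) refl
      (f zero) (sum λ i → f (suc (i ↑ˡ n))) (sum λ i → f (suc (m ↑ʳ i))))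

  sum-place : ∀ {m} (d : Vector ℕ m) (f : Vector Carrier (sumℕ d)) →
              sum f ≈ sum λ j → sum λ i → f (place d j i)
  sum-place {zero}  d f = refl
  sum-place {suc m} d f = trans (sum-+ (d zero) f)
    (+-congˡ (sum-place (tail d) (λ r → f (d zero ↑ʳ r))))

  module _ {n : ℕ} where

    open SelfAdjointOperators ℝ n

    apply : Matrix n n → Operator
    apply M v i = M i ∙ v

    apply-adj : ∀ {M} → (∀ i j → M i j ≈ M j i) → SelfAdjoint (apply M)
    apply-adj {M} M-sym u v = begin
      apply M u ∙ v
        ≈⟨ sum-cong-≋ (λ i → trans (*-comm (M i ∙ u) (v i)) (*-distribˡ-sum (v i) (λ j → M i j * u j))) ⟩
      sum (λ i → sum λ j → v i * (M i j * u j))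
        ≈⟨ ∑-comm (λ i j → v i * (M i j * u j)) ⟩
      sum (λ j → sum λ i → v i * (M i j * u j))
        ≈⟨ sum-cong-≋ (λ j → sum-cong-≋ λ i → trans (*-congˡ (*-congʳ (M-sym i j)))
             (solve 3 (λ v m u → v :* (m :* u) := u :* (m :* v)) refl (v i) (M j i) (u j))) ⟩
      sum (λ j → sum λ i → u j * (M j i * v i))
        ≈⟨ sum-cong-≋ (λ j → *-distribˡ-sum (u j) (λ i → M j i * v i)) ⟨
      u ∙ apply M v  ∎

    -- Each term of w ∙ M w is at most the sum of the squares of its factors, and Cauchy-Schwarz on
    -- the rows turns the second squares into the squared Frobenius norm. A crude constant is enough
    -- for the supremum to exist.
    apply-bounded : ∀ M → BoundedAbove (apply M)
    apply-bounded M = 1# + ‖M‖² , λ w → ≤-trans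
      (sum-mono-≤ λ i → ≤-trans (xy≤xx+yy (w i) (M i ∙ w)) (+-mono-≤ ≤-refl (cauchy-schwarz (M i) w)))
      (inj₂ (begin
        sum (λ i → w i * w i + M i ∙ M i * (w ∙ w))
          ≈⟨ ∑-distrib-+ (λ i → w i * w i) (λ i → M i ∙ M i * (w ∙ w)) ⟩
        w ∙ w + sum (λ i → M i ∙ M i * (w ∙ w))
          ≈⟨ +-congˡ (*-distribʳ-sum (w ∙ w) (λ i → M i ∙ M i)) ⟨
        w ∙ w + ‖M‖² * (w ∙ w)
          ≈⟨ solve 2 (λ s m → s :+ m :* s := (con (+ 1) :+ m) :* s) refl (w ∙ w) ‖M‖² ⟩
        (1# + ‖M‖²) * (w ∙ w)  ∎))
      where
      ‖M‖² : Carrier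
      ‖M‖² = sum λ i → M i ∙ M i

  indicator : Bool → Carrier
  indicator b = if b then 1# else 0#

  indicator-nonneg : ∀ b → 0# ≤ indicator b
  indicator-nonneg true  = inj₁ 0<1
  indicator-nonneg false = ≤-refl

  ∣tabulate∣ : ∀ {n} (f : Fin n → Bool) → ⟦ ∣ tabulate f ∣ ⟧ ≈ sum (indicator ∘ f)
  ∣tabulate∣ {zero}  f = refl
  ∣tabulate∣ {suc n} f with f zero
  ... | true  = +-congˡ (∣tabulate∣ (f ∘ suc))
  ... | false = trans (∣tabulate∣ (f ∘ suc)) (sym (+-identityˡ _))

  -- The graph Laplacian

  module Laplacian {n : ℕ} (G : Graph n) where

    open Graph G

    L : Matrix n n
    L = laplacian G

    adjacency : Matrix n n
    adjacency i j = indicator (does (E? i j))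

    adjacency-sym : ∀ i j → adjacency i j ≡ adjacency j i
    adjacency-sym i j with E? i j | E? j i
    ... | yes _   | yes _   = ≡.refl
    ... | no  _   | no  _   = ≡.refl
    ... | yes Eij | no ¬Eji = contradiction (E-sym Eij) ¬Eji
    ... | no ¬Eij | yes Eji = contradiction (E-sym Eji) ¬Eij

    adjacency-diagonal : ∀ i → adjacency i i ≡ 0#
    adjacency-diagonal i = ≡.cong indicator (dec-false (E? i i) (E-irrefl ≡.refl))

    L-diagonal : ∀ i → L i i ≡ ⟦ deg i ⟧
    L-diagonal i with i Fin.≟ i
    ... | yes _  = ≡.refl
    ... | no i≢i = contradiction ≡.refl i≢i

    L-off-diagonal : ∀ {i j} → i ≢ j → L i j ≈ - adjacency i j
    L-off-diagonal {i} {j} i≢j with i Fin.≟ j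
    ... | yes i≡j = contradiction i≡j i≢j
    ... | no  _ with does (E? i j)
    ...   | true  = refl
    ...   | false = solve 0 (con (+ 0) := :- con (+ 0)) refl

    L-sym : ∀ i j → L i j ≈ L j i
    L-sym i j = by-cases (i Fin.≟ j)
      where
      by-cases : Dec (i ≡ j) → L i j ≈ L j i
      by-cases (yes ≡.refl) = refl
      by-cases (no i≢j)     = trans (L-off-diagonal i≢j)
        (trans (-‿cong (reflexive (adjacency-sym i j))) (sym (L-off-diagonal (i≢j ∘ ≡.sym))))

    -- L + adjacency is the diagonal matrix of degrees. So in the difference of the two sides only
    -- the term j = i survives, and it cancels against v i times the degree.
    L-apply : ∀ v i → L i ∙ v ≈ sum λ j → adjacency i j * (v i - v j)
    L-apply v i = x-y≈0⇒x≈y (begin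
      L i ∙ v - sum (λ j → adjacency i j * (v i - v j))
        ≈⟨ solve 2 (λ x y → x :- y := x :+ (:- con (+ 1)) :* y)
             refl (L i ∙ v) (sum λ j → adjacency i j * (v i - v j)) ⟩
      L i ∙ v + - 1# * sum (λ j → adjacency i j * (v i - v j))
        ≈⟨ +-congˡ (*-distribˡ-sum (- 1#) (λ j → adjacency i j * (v i - v j))) ⟩
      L i ∙ v + sum (λ j → - 1# * (adjacency i j * (v i - v j)))
        ≈⟨ ∑-distrib-+ (λ j → L i j * v j) (λ j → - 1# * (adjacency i j * (v i - v j))) ⟨
      sum (λ j → L i j * v j + - 1# * (adjacency i j * (v i - v j)))
        ≈⟨ sum-cong-≋ (λ j → solve 4 (λ l a x y → l :* y :+ (:- con (+ 1)) :* (a :* (x :- y)) := (l :+ a) :* y :+ (:- x) :* a)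
             refl (L i j) (adjacency i j) (v i) (v j)) ⟩
      sum (λ j → (L i j + adjacency i j) * v j + - v i * adjacency i j)
        ≈⟨ ∑-distrib-+ (λ j → (L i j + adjacency i j) * v j) (λ j → - v i * adjacency i j) ⟩
      sum (λ j → (L i j + adjacency i j) * v j) + sum (λ j → - v i * adjacency i j)
        ≈⟨ +-cong (sum-single i λ j j≢i → trans (*-congʳ (off j j≢i)) (zeroˡ (v j)))
                  (sym (*-distribˡ-sum (- v i) (adjacency i))) ⟩
      (L i i + adjacency i i) * v i + - v i * sum (adjacency i)
        ≈⟨ +-cong (*-congʳ (+-cong (reflexive (L-diagonal i)) (reflexive (adjacency-diagonal i))))
                  (*-congˡ (sym (∣tabulate∣ (λ j → does (E? i j))))) ⟩
      (⟦ deg i ⟧ + 0#) * v i + - v i * ⟦ deg i ⟧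
        ≈⟨ solve 2 (λ d x → (d :+ con (+ 0)) :* x :+ (:- x) :* d := con (+ 0)) refl ⟦ deg i ⟧ (v i) ⟩
      0#  ∎)
      where
      off : ∀ j → j ≢ i → L i j + adjacency i j ≈ 0#
      off j j≢i = trans (+-congʳ (L-off-diagonal (j≢i ∘ ≡.sym)))
        (solve 1 (λ x → (:- x) :+ x := con (+ 0)) refl (adjacency i j))

    1ᵥ : ℝ^ n
    1ᵥ _ = 1#

    L-1ᵥ : ∀ i → L i ∙ 1ᵥ ≈ 0#
    L-1ᵥ i = trans (L-apply 1ᵥ i)
      (sum-zero λ j → trans (*-congˡ (-‿inverseʳ 1#)) (zeroʳ (adjacency i j)))

    -- The Dirichlet form: summing (v i - v j)² over ordered adjacent pairs counts every edge twice,
    -- hence the factor 2.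
    L-psd : ∀ v → 0# ≤ v ∙ apply L v
    L-psd v = *-cancelˡ-≤ (nonneg⇒0<x+1 (inj₁ 0<1)) (≤-respˡ-≈ (sym (zeroʳ (1# + 1#))) (≤-respʳ-≈ doubled
      (sum-nonneg λ i → sum-nonneg λ j →
        *-nonneg (indicator-nonneg (does (E? i j))) (square-nonneg (v i - v j)))))
      where
      form : Fin n → Fin n → Carrier
      form i j = v i * (adjacency i j * (v i - v j))

      energy : v ∙ apply L v ≈ sum λ i → sum λ j → form i j
      energy = sum-cong-≋ λ i → trans (*-congˡ (L-apply v i))
        (*-distribˡ-sum (v i) (λ j → adjacency i j * (v i - v j)))

      doubled : sum (λ i → sum λ j → adjacency i j * ((v i - v j) * (v i - v j))) ≈
                (1# + 1#) * (v ∙ apply L v)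
      doubled = begin
        sum (λ i → sum λ j → adjacency i j * ((v i - v j) * (v i - v j)))
          ≈⟨ sum-cong-≋ (λ i → sum-cong-≋ λ j → trans
               (solve 3 (λ a x y → a :* ((x :- y) :* (x :- y)) := x :* (a :* (x :- y)) :+ y :* (a :* (y :- x)))
                    refl (adjacency i j) (v i) (v j))
               (+-congˡ (*-congˡ (*-congʳ (reflexive (adjacency-sym i j)))))) ⟩
        sum (λ i → sum λ j → form i j + form j i)
          ≈⟨ sum-cong-≋ (λ i → ∑-distrib-+ (form i) (λ j → form j i)) ⟩
        sum (λ i → sum (form i) + sum λ j → form j i)
          ≈⟨ ∑-distrib-+ (λ i → sum (form i)) (λ i → sum λ j → form j i) ⟩
        sum (λ i → sum (form i)) + sum (λ i → sum λ j → form j i)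
          ≈⟨ +-congˡ (∑-comm (λ i j → form j i)) ⟩
        sum (λ i → sum (form i)) + sum (λ i → sum (form i))
          ≈⟨ +-cong energy energy ⟨
        v ∙ apply L v + v ∙ apply L v
          ≈⟨ solve 1 (λ x → x :+ x := (con (+ 1) :+ con (+ 1)) :* x) refl (v ∙ apply L v) ⟩
        (1# + 1#) * (v ∙ apply L v)  ∎

-- Designs and the row space of B

module Designs
  {c ℓ₁ ℓ₂ : Level} (ℝ : CompleteOrderedField c ℓ₁ ℓ₂) {n k t : ℕ} (G : Graph n)
  (ev : OverReals.ℝ^ ℝ (suc k))
  (isDistinct : OverReals.IsDistinctEigenvalues ℝ (OverReals.laplacian ℝ G) ev)
  (t<k : t ℕ.< k)
  (d : Vector ℕ (k ∸ t)) (bases : ∀ j → Vector (OverReals.ℝ^ ℝ n) (d j))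
  (isBasis : ∀ j → OverReals.IsBasis ℝ
    (OverReals.Eigenspace ℝ (OverReals.laplacian ℝ G) (ev (upper t<k j))) (bases j))
  where

  open OrderedFieldProperties ℝ
  open Matrices ℝ
  open Laplacian G
  open IsDistinctEigenvalues isDistinct
  open SpectralTheorem ℝ n (apply-adj L-sym) (apply-bounded L)

  lowerEv : Vector Carrier (suc t)
  lowerEv = ev ∘ lower t<k

  upperEv : Vector Carrier (k ∸ t)
  upperEv = ev ∘ upper t<k

  OrthogonalToLower : ℝ^ n → Set (c ⊔ ℓ₁)
  OrthogonalToLower g = ∀ i {w} → Eigenvector (lowerEv i) w → g ∙ w ≈ 0#

  distinct : ∀ {i j} → i Fin.< j → ¬ (ev i ≈ ev j)
  distinct i<j ev≈ = irrefl ev≈ (increasing i<j)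

  upper-distinct : ∀ {i j} → i ≢ j → ¬ (upperEv i ≈ upperEv j)
  upper-distinct {i} {j} i≢j with Fin.<-cmp i j
  ... | tri< i<j _ _ = distinct (upper-mono-< t<k i<j)
  ... | tri≈ _ i≡j _ = contradiction i≡j i≢j
  ... | tri> _ _ j<i = distinct (upper-mono-< t<k j<i) ∘ sym

  exhaustive-split : ∀ {μ w} → ¬ (w ≋ 0ᵥ) → Eigenvector μ w →
                     (∃ λ i → μ ≈ lowerEv i) ⊎ (∃ λ j → μ ≈ upperEv j)
  exhaustive-split {μ} {w} w≄0 eig with exhaustive μ (w , w≄0 , eig)
  ... | i , μ≈ with lower-or-upper t<k i
  ...   | inj₁ (l , ≡.refl) = inj₁ (l , μ≈)
  ...   | inj₂ (j , ≡.refl) = inj₂ (j , μ≈)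

  rows : Vector (ℝ^ n) (sumℕ d)
  rows = stack d bases

  combination-rows : ∀ a → combination a rows ≋ sumᵥ λ j → combination (a ∘ place d j) (bases j)
  combination-rows a v = trans (sum-place d λ r → a r * rows r v)
    (sum-cong-≋ λ j → sum-cong-≋ λ i → *-congˡ (reflexive (≡.cong (λ b → b v) (stack-place d bases j i))))

  Eigenvector-sumᵥ : ∀ {μ m} {f : Vector (ℝ^ n) m} → (∀ j → Eigenvector μ (f j)) → Eigenvector μ (sumᵥ f)
  Eigenvector-sumᵥ {μ} {f = f} eig i = trans (T-sumᵥ f i)
    (trans (sum-cong-≋ λ j → eig j i) (sym (*-distribˡ-sum μ λ j → f j i)))

  block-eigenvector : ∀ j x → Eigenvector (upperEv j) (combination x (bases j))
  block-eigenvector j x = Eigenvector-sumᵥ λ i → Eigenvector-• (x i) (IsBasis.member (isBasis j) i)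

  rows-orthogonal-to-lower : ∀ a → OrthogonalToLower (combination a rows)
  rows-orthogonal-to-lower a i {w} eig = begin
    combination a rows ∙ w                    ≈⟨ ∙-congʳ w (combination-rows a) ⟩
    sumᵥ blocks ∙ w                           ≈⟨ ∙-sumᵥˡ blocks w ⟩
    sum (λ j → blocks j ∙ w)                  ≈⟨ sum-zero (λ j → eigenvectors-orthogonal
                                                   (distinct (lower<upper t<k i j) ∘ sym)
                                                   (block-eigenvector j (a ∘ place d j)) eig) ⟩
    0#                                        ∎
    where
    blocks : Vector (ℝ^ n) (k ∸ t)
    blocks j = combination (a ∘ place d j) (bases j)

  -- The blocks of a combination lie in distinct eigenspaces and are mutually orthogonal. Pairing
  -- the vanishing total with one block leaves its squared norm, after which independence within the
  -- block applies.
  rows-independent : ∀ a → combination a rows ≋ 0ᵥ → a ≋ 0ᵥ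
  rows-independent a eq r with place-surjective d r
  ... | j , i , ≡.refl = IsBasis.independent (isBasis j) (a ∘ place d j) (norm≈0⇒≋0 (begin
    blocks j ∙ blocks j                       ≈⟨ sum-single j (λ i i≢j → eigenvectors-orthogonal
                                                   (upper-distinct i≢j) (eig i) (eig j)) ⟨
    sum (λ i → blocks i ∙ blocks j)           ≈⟨ ∙-sumᵥˡ blocks (blocks j) ⟨
    sumᵥ blocks ∙ blocks j                    ≈⟨ ∙-congʳ (blocks j) (combination-rows a) ⟨
    combination a rows ∙ blocks j             ≈⟨ ∙-zeroˡ (blocks j) eq ⟩
    0#                                        ∎)) i
    where
    blocks : Vector (ℝ^ n) (k ∸ t)
    blocks j = combination (a ∘ place d j) (bases j)
    eig : ∀ j → Eigenvector (upperEv j) (blocks j)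
    eig j = block-eigenvector j (a ∘ place d j)

  -- The row space is all of the orthogonal complement of the lower eigenspaces. The spectral
  -- theorem enters here.
  orthogonal-to-lower⇒in-rows : ∀ {g} → OrthogonalToLower g → ∃ λ a → g ≋ combination a rows
  orthogonal-to-lower⇒in-rows {g} g⟂ = stack d coef , λ v → begin
    g v                                                            ≈⟨ g≋ v ⟩
    sum (λ j → h j v)                                              ≈⟨ sum-cong-≋ (λ j → h≋ j v) ⟩
    sum (λ j → combination (coef j) (bases j) v)                   ≈⟨ sum-cong-≋ (λ j → sum-cong-≋ λ i →
                                                                        *-congʳ (reflexive (stack-place d coef j i))) ⟨
    sum (λ j → combination (stack d coef ∘ place d j) (bases j) v) ≈⟨ combination-rows (stack d coef) v ⟨
    combination (stack d coef) rows v                              ∎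
    where
    decomposition : ∃ λ h → (∀ j → Eigenvector (upperEv j) (h j)) × g ≋ sumᵥ h
    decomposition = orthogonal⇒sum-of-complementary lowerEv upperEv
      (distinct ∘ upper-mono-< t<k) exhaustive-split g⟂
    h : Vector (ℝ^ n) (k ∸ t)
    h = proj₁ decomposition
    g≋ : g ≋ sumᵥ h
    g≋ = proj₂ (proj₂ decomposition)
    spanned : ∀ j → ∃ λ a → h j ≋ combination a (bases j)
    spanned j = IsBasis.spanning (isBasis j) (h j) (proj₁ (proj₂ decomposition) j)
    coef : ∀ j → Vector Carrier (d j)
    coef j = proj₁ (spanned j)
    h≋ : ∀ j → h j ≋ combination (coef j) (bases j)
    h≋ j = proj₂ (spanned j)

  eigenvalue-nonneg : ∀ i → 0# ≤ ev i
  eigenvalue-nonneg i with eigenvalue i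
  ... | v , v≄0 , eig = *-cancelˡ-≤ (norm-pos v≄0) (≤-respˡ-≈ (sym (zeroʳ (v ∙ v)))
    (≤-respʳ-≈ (trans (∙-congˡ v eig) (trans (∙-•ʳ (ev i) v v) (*-comm (ev i) (v ∙ v)))) (L-psd v)))

  -- `1ᵥ` makes 0 an eigenvalue, and as none is negative the smallest one, `ev zero`, is 0. The
  -- index excludes n = 0, where `1ᵥ` would be the zero vector.
  1ᵥ-eigenvector : Fin n → Eigenvector (ev zero) 1ᵥ
  1ᵥ-eigenvector v i = trans (L-1ᵥ i) (trans (sym (zeroˡ 1#)) (*-congʳ 0≈ev₀))
    where
    zero-eigenvalue : ∃ λ j → 0# ≈ ev j
    zero-eigenvalue = exhaustive 0# (1ᵥ , (λ 1≋0 → 1≉0 (1≋0 v)) , λ i → trans (L-1ᵥ i) (sym (zeroˡ 1#)))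

    first : (∃ λ j → 0# ≈ ev j) → 0# ≈ ev zero
    first (zero  , 0≈) = 0≈
    first (suc j , 0≈) = contradiction (eigenvalue-nonneg zero)
      (<⇒≱ (<-respʳ-≈ (sym 0≈) (increasing (ℕ.s≤s ℕ.z≤n))))

    0≈ev₀ : 0# ≈ ev zero
    0≈ev₀ = first zero-eigenvalue

  1ᵥ∙ : ∀ f → 1ᵥ ∙ f ≈ sum f
  1ᵥ∙ f = sum-cong-≋ {n} λ i → *-identityˡ (f i)

  sum-1ᵥ : sum 1ᵥ ≈ ⟦ n ⟧
  sum-1ᵥ = sum-replicate n

  -- A hyperplane would make aᵀB a constant vector x 1. Orthogonality to 1 gives n x = 0, and
  -- independence of the rows then gives a = 0.
  not-in-hyperplane : Fin n → ¬ InAffineHyperplane (eigenconfiguration d bases)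
  not-in-hyperplane v (a , x , a≄0 , a∙b≈x) = a≄0 (rows-independent a λ i → trans (a∙b≈x i) x≈0)
    where
    x≈0 : x ≈ 0#
    x≈0 = *-≈0 (pos⇒≉0 (Fin⇒⟦⟧-pos v)) (begin
      ⟦ n ⟧ * x                   ≈⟨ trans (*-comm ⟦ n ⟧ x) (*-congˡ (sym sum-1ᵥ)) ⟩
      x * sum 1ᵥ                  ≈⟨ *-congˡ (1ᵥ∙ 1ᵥ) ⟨
      x * 1ᵥ ∙ 1ᵥ                 ≈⟨ ∙-•ˡ x 1ᵥ 1ᵥ ⟨
      (x • 1ᵥ) ∙ 1ᵥ               ≈⟨ ∙-congʳ 1ᵥ (λ i → trans (*-identityʳ x) (sym (a∙b≈x i))) ⟩
      combination a rows ∙ 1ᵥ     ≈⟨ rows-orthogonal-to-lower a zero (1ᵥ-eigenvector v) ⟩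
      0#                          ∎)

  ∉⇒outside : ∀ {W : Subset n} {i} → i ∉ W → lookup W i ≡ false
  ∉⇒outside {W} {i} i∉W with lookup W i in eq
  ... | true  = contradiction (lookup⇒[]= i W eq) i∉W
  ... | false = ≡.refl

  χ : Subset n → ℝ^ n
  χ W w = indicator (lookup W w)

  -- The g of the overview: its pairing with f is the weighted sum over W minus the mean of f.
  deviation : Subset n → Carrier → ℝ^ n
  deviation W α = α • χ W -ᵥ ⟦ n ⟧ ⁻¹ • 1ᵥ

  deviation-∙ : ∀ W α f → deviation W α ∙ f ≈ α * χ W ∙ f - ⟦ n ⟧ ⁻¹ * sum f
  deviation-∙ W α f = trans (∙--ˡ (α • χ W) (⟦ n ⟧ ⁻¹ • 1ᵥ) f)
    (+-cong (∙-•ˡ α (χ W) f) (-‿cong (trans (∙-•ˡ (⟦ n ⟧ ⁻¹) 1ᵥ f) (*-congˡ (1ᵥ∙ f)))))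

  module _ {W : Subset n} {a : ℝ^ n} {α : Carrier} (a≈α : ∀ w → w ∈ W → a w ≈ α) where

    -- `a` agrees with α only inside W; outside, the indicator removes the term whatever the weight
    -- is.
    weighted-sum : ∀ f → sum (λ w → if lookup W w then a w * f w else 0#) ≈ α * χ W ∙ f
    weighted-sum f = trans (sum-cong-≋ λ w → pointwise w (lookup W w) ≡.refl)
      (sym (*-distribˡ-sum α λ w → χ W w * f w))
      where
      pointwise : ∀ w b → lookup W w ≡ b →
                  (if b then a w * f w else 0#) ≈ α * (indicator (lookup W w) * f w)
      pointwise w true  eq = trans (*-congʳ (a≈α w (lookup⇒[]= w W eq)))
        (*-congˡ (trans (sym (*-identityˡ (f w))) (*-congʳ (reflexive (≡.cong indicator (≡.sym eq))))))
      pointwise w false eq = sym (trans (*-congˡ (trans (*-congʳ (reflexive (≡.cong indicator eq))) (zeroˡ (f w)))) (zeroʳ α))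

    averages⇒deviation⟂ : ∀ {f} → Averages W a f → deviation W α ∙ f ≈ 0#
    averages⇒deviation⟂ {f} avg = trans (deviation-∙ W α f) (x≈y⇒x-y≈0 (sym (trans avg (weighted-sum f))))

    deviation⟂⇒averages : ∀ {f} → deviation W α ∙ f ≈ 0# → Averages W a f
    deviation⟂⇒averages {f} ⟂ =
      trans (sym (x-y≈0⇒x≈y (trans (sym (deviation-∙ W α f)) ⟂))) (sym (weighted-sum f))

    -- Designs are tested on sums over all lower indices. A single eigenvector of index l is such a
    -- sum, with the zero vector at every other index.
    design⇒deviation⟂lower : IsDesign G ev t<k W a → OrthogonalToLower (deviation W α)
    design⇒deviation⟂lower design l {w} eig = averages⇒deviation⟂ (design w (g , member , w≋))
      where
      select : Bool → ℝ^ n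
      select b = if b then w else 0ᵥ
      g : Vector (ℝ^ n) (suc t)
      g i = select (does (i Fin.≟ l))
      by-cases : ∀ i → Dec (i ≡ l) → Eigenvector (lowerEv i) (g i)
      by-cases i (yes ≡.refl) = ≡.subst (λ b → Eigenvector (lowerEv i) (select b))
        (≡.sym (dec-true (i Fin.≟ i) ≡.refl)) eig
      by-cases i (no i≢l) = ≡.subst (λ b → Eigenvector (lowerEv i) (select b))
        (≡.sym (dec-false (i Fin.≟ l) i≢l))
        λ r → trans (∙-zeroʳ (L r) λ _ → refl) (sym (zeroʳ (lowerEv i)))
      member : ∀ i → Eigenvector (lowerEv i) (g i)
      member i = by-cases i (i Fin.≟ l)
      w≋ : w ≋ sumᵥ g
      w≋ v = sym (trans
        (sum-single l λ i i≢l → reflexive (≡.cong (λ b → select b v) (dec-false (i Fin.≟ l) i≢l)))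
        (reflexive (≡.cong (λ b → select b v) (dec-true (l Fin.≟ l) ≡.refl))))

    deviation⟂lower⇒design : OrthogonalToLower (deviation W α) → IsDesign G ev t<k W a
    deviation⟂lower⇒design ⟂ f (h , member , f≋) = deviation⟂⇒averages (begin
      deviation W α ∙ f                   ≈⟨ ∙-comm (deviation W α) f ⟩
      f ∙ deviation W α                   ≈⟨ ∙-congʳ (deviation W α) f≋ ⟩
      sumᵥ h ∙ deviation W α              ≈⟨ ∙-sumᵥˡ h (deviation W α) ⟩
      sum (λ i → h i ∙ deviation W α)     ≈⟨ sum-zero (λ i → trans (∙-comm (h i) (deviation W α)) (⟂ i (member i))) ⟩
      0#                                  ∎)

  -- Both values must be attained: - 1 / n at a point that the proper subset W misses, α - 1 / n at
  -- a point of W, which must be shown to exist.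
  uniform-design⇒two-valued :
    (∃ λ W → W ⊂ ⊤ × IsUniformDesign G ev t<k W) → TwoValued (eigenconfiguration d bases)
  uniform-design⇒two-valued (W , (_ , v , _ , v∉W) , a , (α , 0<α , a≈α) , design) =
    not-in-hyperplane v , coefs , value true , value false , distinct-values ,
    attained (proj₂ W-nonempty) , (v , trans (a∙b≈ v) (reflexive (≡.cong value (∉⇒outside v∉W)))) , two-values
    where
    value : Bool → Carrier
    value b = α * indicator b - ⟦ n ⟧ ⁻¹ * 1#

    ⟂ : OrthogonalToLower (deviation W α)
    ⟂ = design⇒deviation⟂lower a≈α design

    in-rows : ∃ λ b → deviation W α ≋ combination b rows
    in-rows = orthogonal-to-lower⇒in-rows ⟂

    coefs : ℝ^ (sumℕ d)
    coefs = proj₁ in-rows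

    a∙b≈ : ∀ i → coefs ∙ eigenconfiguration d bases i ≈ value (lookup W i)
    a∙b≈ i = sym (proj₂ in-rows i)

    distinct-values : ¬ (value true ≈ value false)
    distinct-values eq = pos⇒≉0 0<α (begin
      α                             ≈⟨ solve 2 (λ α y → α := (α :* con (+ 1) :- y) :- (α :* con (+ 0) :- y)) refl α (⟦ n ⟧ ⁻¹ * 1#) ⟩
      value true - value false      ≈⟨ x≈y⇒x-y≈0 eq ⟩
      0#                            ∎)

    two-values : ∀ i → coefs ∙ eigenconfiguration d bases i ≈ value true ⊎
                       coefs ∙ eigenconfiguration d bases i ≈ value false
    two-values i = by-value (lookup W i) (a∙b≈ i)
      where
      by-value : ∀ {z} b → z ≈ value b → z ≈ value true ⊎ z ≈ value false
      by-value true  = inj₁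
      by-value false = inj₂

    attained : ∀ {i} → i ∈ W → ∃ λ i → coefs ∙ eigenconfiguration d bases i ≈ value true
    attained {i} i∈W = i , trans (a∙b≈ i) (reflexive (≡.cong value ([]=⇒lookup i∈W)))

    by-cases : Dec (Nonempty W) → Nonempty W
    by-cases (yes ne)   = ne
    -- For empty W the design property on the all-ones vector reads 1 = 0.
    by-cases (no empty) = contradiction (begin
      1#                                       ≈⟨ *-inverseˡ ⟦ n ⟧ (pos⇒≉0 (Fin⇒⟦⟧-pos v)) ⟨
      ⟦ n ⟧ ⁻¹ * ⟦ n ⟧                         ≈⟨ *-congˡ sum-1ᵥ ⟨
      ⟦ n ⟧ ⁻¹ * sum 1ᵥ                        ≈⟨ x-y≈0⇒x≈y (trans (sym (deviation-∙ W α 1ᵥ)) (⟂ zero (1ᵥ-eigenvector v))) ⟨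
      α * χ W ∙ 1ᵥ                             ≈⟨ *-congˡ (∙-zeroˡ 1ᵥ χ≋0) ⟩
      α * 0#                                   ≈⟨ zeroʳ α ⟩
      0#                                       ∎) 1≉0
      where
      χ≋0 : χ W ≋ 0ᵥ
      χ≋0 i = reflexive (≡.cong indicator (∉⇒outside λ i∈W → empty (i , i∈W)))

    W-nonempty : Nonempty W
    W-nonempty = by-cases (nonempty? W)

  two-valued⇒uniform-design :
    TwoValued (eigenconfiguration d bases) → ∃ λ W → W ⊂ ⊤ × IsUniformDesign G ev t<k W
  two-valued⇒uniform-design (_ , a , x , y , x≉y , (i₀ , f₀≈x) , (i₁ , f₁≈y) , x-or-y) =
    -- `i₀`, where f takes the value x, is the point that W misses. S is the cardinality of W,
    -- written as `χ W ∙ 1ᵥ`.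
    W , (⊆⊤ , i₀ , ∈⊤ , i₀∉W) , (λ _ → S ⁻¹) , (S ⁻¹ , ⁻¹-pos 0<S , λ _ _ → refl) ,
    deviation⟂lower⇒design {W} (λ _ _ → refl) λ l {w} eig → *-≈0 cS≉0 (begin
      Δ * S * deviation W (S ⁻¹) ∙ w         ≈⟨ ∙-•ˡ (Δ * S) (deviation W (S ⁻¹)) w ⟨
      ((Δ * S) • deviation W (S ⁻¹)) ∙ w       ≈⟨ ∙-congʳ w f≋ ⟨
      f ∙ w                                   ≈⟨ rows-orthogonal-to-lower a l eig ⟩
      0#                                      ∎)
    where
    f : ℝ^ n
    f = combination a rows

    N Δ S : Carrier
    N  = ⟦ n ⟧
    Δ = y - x

    -- Either value could define W: Δ may be negative, but its sign stays in the scalar Δ S and does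
    -- not reach the weight 1 / S.
    W : Subset n
    W = tabulate λ i → does (f i ≈? y)

    S = χ W ∙ 1ᵥ

    lookup-W : ∀ i → lookup W i ≡ does (f i ≈? y)
    lookup-W = lookup∘tabulate λ i → does (f i ≈? y)

    χ-inside : ∀ {i} → f i ≈ y → χ W i ≈ 1#
    χ-inside {i} fi≈y = reflexive (≡.cong indicator (≡.trans (lookup-W i) (dec-true (f i ≈? y) fi≈y)))

    outside : ∀ {i} → f i ≈ x → lookup W i ≡ false
    outside {i} fi≈x = ≡.trans (lookup-W i) (dec-false (f i ≈? y) λ fi≈y → x≉y (trans (sym fi≈x) fi≈y))

    i₀∉W : i₀ ∉ W
    i₀∉W i₀∈W = contradiction (≡.trans (≡.sym ([]=⇒lookup i₀∈W)) (outside f₀≈x)) λ ()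

    N≉0 : ¬ (N ≈ 0#)
    N≉0 = pos⇒≉0 (Fin⇒⟦⟧-pos i₀)

    0<S : 0# < S
    0<S = nonneg∧≉0⇒pos (sum-nonneg terms) λ S≈0 → 1≉0 (begin
      1#               ≈⟨ trans (*-identityʳ (χ W i₁)) (χ-inside f₁≈y) ⟨
      χ W i₁ * 1#      ≈⟨ sum-nonneg≈0 terms S≈0 i₁ ⟩
      0#               ∎)
      where
      terms : ∀ i → 0# ≤ χ W i * 1#
      terms i = *-nonneg (indicator-nonneg (lookup W i)) (inj₁ 0<1)

    f≈x+cχ : f ≋ x • 1ᵥ +ᵥ Δ • χ W
    f≈x+cχ i = by-cases (x-or-y i)
      where
      by-cases : f i ≈ x ⊎ f i ≈ y → f i ≈ x * 1# + Δ * χ W i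
      by-cases (inj₁ fi≈x) = trans fi≈x (trans
        (solve 2 (λ x c → x := x :* con (+ 1) :+ c :* con (+ 0)) refl x Δ)
        (+-congˡ (*-congˡ (reflexive (≡.cong indicator (≡.sym (outside fi≈x)))))))
      by-cases (inj₂ fi≈y) = trans fi≈y (trans
        (solve 2 (λ x y → y := x :* con (+ 1) :+ (y :- x) :* con (+ 1)) refl x y)
        (+-congˡ (*-congˡ (sym (χ-inside fi≈y)))))

    xN+cS≈0 : x * N + Δ * S ≈ 0#
    xN+cS≈0 = begin
      x * N + Δ * S                        ≈⟨ +-congʳ (*-congˡ (trans (1ᵥ∙ 1ᵥ) sum-1ᵥ)) ⟨
      x * 1ᵥ ∙ 1ᵥ + Δ * χ W ∙ 1ᵥ           ≈⟨ trans (∙-+ˡ (x • 1ᵥ) (Δ • χ W) 1ᵥ) (+-cong (∙-•ˡ x 1ᵥ 1ᵥ) (∙-•ˡ Δ (χ W) 1ᵥ)) ⟨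
      (x • 1ᵥ +ᵥ Δ • χ W) ∙ 1ᵥ             ≈⟨ ∙-congʳ 1ᵥ f≈x+cχ ⟨
      f ∙ 1ᵥ                                ≈⟨ rows-orthogonal-to-lower a zero (1ᵥ-eigenvector i₀) ⟩
      0#                                    ∎

    cS≉0 : ¬ (Δ * S ≈ 0#)
    cS≉0 eq = x≉y (sym (x-y≈0⇒x≈y (*-≈0 (pos⇒≉0 0<S) (trans (*-comm S Δ) eq))))

    -- By x N = - Δ S the constant part of f is - Δ S / N, the constant part of the scaled
    -- deviation. In the chain N ⁻¹ (Δ S) is added and subtracted so that the known zero x N + Δ S
    -- appears.
    f≋ : f ≋ (Δ * S) • deviation W (S ⁻¹)
    f≋ i = begin
      f i                                               ≈⟨ f≈x+cχ i ⟩
      x * 1# + Δ * z                                   ≈⟨ +-cong (*-congˡ (*-inverseˡ N N≉0)) (*-congʳ (*-identityʳ Δ)) ⟨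
      x * (N ⁻¹ * N) + Δ * 1# * z                      ≈⟨ +-congˡ (*-congʳ (*-congˡ (*-inverseʳ S (pos⇒≉0 0<S)))) ⟨
      x * (N ⁻¹ * N) + Δ * (S * S ⁻¹) * z              ≈⟨ +-cong
                                                             (solve 3 (λ x M N → x :* (M :* N) := M :* (x :* N))
                                                                  refl x (N ⁻¹) N)
                                                             (solve 4 (λ c S I z → c :* (S :* I) :* z := c :* S :* (I :* z))
                                                                  refl Δ S (S ⁻¹) z) ⟩
      N ⁻¹ * (x * N) + Δ * S * (S ⁻¹ * z)              ≈⟨ solve 4 (λ M p q r → M :* p :+ q :* r := M :* (p :+ q) :+ q :* (r :- M :* con (+ 1)))
                                                             refl (N ⁻¹) (x * N) (Δ * S) (S ⁻¹ * z) ⟩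
      N ⁻¹ * (x * N + Δ * S) + Δ * S * (S ⁻¹ * z - N ⁻¹ * 1#)
                                                        ≈⟨ trans (+-congʳ (trans (*-congˡ xN+cS≈0) (zeroʳ (N ⁻¹)))) (+-identityˡ _) ⟩
      Δ * S * (S ⁻¹ * z - N ⁻¹ * 1#)                   ∎
      where
      z : Carrier
      z = χ W i

theorem2p5 : ∀ {c ℓ₁ ℓ₂ : Level} (ℝ : CompleteOrderedField c ℓ₁ ℓ₂) →
    let open OverReals ℝ in
    ∀ {n k t : ℕ} (G : Graph n) → Graph.Connected G →
    (ev : ℝ^ (suc k)) → IsDistinctEigenvalues (laplacian G) ev →
    1 ℕ.≤ t → (t<k : t ℕ.< k) →
    (d : Vector ℕ (k ∸ t)) (bases : ∀ j → Vector (ℝ^ n) (d j)) →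
    (∀ j → IsBasis (Eigenspace (laplacian G) (ev (upper t<k j))) (bases j)) →
    (∃ λ (W : Subset n) → W ⊂ ⊤ × IsUniformDesign G ev t<k W)
    ⇔ TwoValued (eigenconfiguration d bases)
theorem2p5 ℝ G _ ev isDistinct _ t<k d bases isBasis =
  mk⇔ uniform-design⇒two-valued two-valued⇒uniform-design
  where open Designs ℝ G ev isDistinct t<k d bases isBasis
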